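{- Let $\Delta_n$ denote the maximum degree of a graph drawn uniformly at random from the graphs in $\mathrm{Ex}(C_6)$ with $n$ vertices. Then there is a constant $C>0$ such that $$\Delta_n \le C\frac{\log n}{\log\log\log n}\qquad\text{w.h.p.}$$
   Context: All graphs are labelled. $\mathrm{Ex}(C_6)$ is the class of labelled graphs not containing the 6-cycle $C_6$ as a minor; a random graph of size $n$ is drawn uniformly from the graphs in the class on vertex set $\{1,\dots,n\}$. An event holds with high probability (w.h.p.) if its probability tends to $1$ as $n\to\infty$. $\log$ is the natural logarithm. -}

module Defs where

open import Data.Nat using (ℕ; zero; suc; _+_; _*_; _⊔_; _≤_)
open import Data.Nat.Logarithm using (⌊log₂_⌋)
open import Data.Bool using (Bool; true; false; if_then_else_)
open import Data.Fin using (Fin)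
open import Data.Vec using (Vec; lookup; tabulate; toList)
open import Data.List using (List; length; foldr; map)
open import Data.Nat.ListAction using (sum)
open import Data.List.Relation.Unary.Unique.Propositional using (Unique)
open import Data.List.Membership.Propositional using (_∈_)
open import Data.Maybe using (Maybe; just)
open import Data.Product using (Σ; ∃; ∃-syntax; _×_)
open import Relation.Binary.PropositionalEquality using (_≡_)
open import Relation.Nullary using (¬_)
open import Function.Bundles using (_⇔_)

-- A labelled graph on vertex set Fin n (= {1..n}) is given by its adjacency matrix.
Matrix : ℕ → Set
Matrix n = Vec (Vec Bool n) n

Adj : ∀ {n} → Matrix n → Fin n → Fin n → Set
Adj M i j = lookup (lookup M i) j ≡ true

IsSimple : ∀ {n} → Matrix n → Set
IsSimple {n} M = (∀ i j → Adj M i j → Adj M j i) × (∀ (i : Fin n) → ¬ Adj M i i)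

degree : ∀ {n} → Matrix n → Fin n → ℕ
degree M i = sum (map (λ b → if b then 1 else 0) (toList (lookup M i)))

maxDegree : ∀ {n} → Matrix n → ℕ
maxDegree M = foldr _⊔_ 0 (toList (tabulate (degree M)))

data Walk {n} (G : Matrix n) (S : Fin n → Set) : Fin n → Fin n → Set where
  [_]  : ∀ {u} → S u → Walk G S u u
  step : ∀ {u w v} → S u → Adj G u w → Walk G S w v → Walk G S u v

-- H (on Fin m) is a minor of G (on Fin n): there is a minor model, i.e.
-- pairwise disjoint (β is a partial function) nonempty connected branch sets,
-- with a G-edge between the branch sets of every H-edge.
IsMinor : ∀ {m n} → Matrix m → Matrix n → Set
IsMinor {m} {n} H G =
  Σ (Fin n → Maybe (Fin m)) λ β →
    (∀ h → ∃[ v ] β v ≡ just h)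
  × (∀ h u v → β u ≡ just h → β v ≡ just h → Walk G (λ x → β x ≡ just h) u v)
  × (∀ h h' → Adj H h h' → ∃[ u ] ∃[ v ] (β u ≡ just h × β v ≡ just h' × Adj G u v))

succ6 : Fin 6 → Fin 6
succ6 i = Data.Fin.fromℕ< (m%n<n (suc (Data.Fin.toℕ i)) 6)
  where open import Data.Nat.DivMod using (m%n<n)

C6 : Matrix 6
C6 = tabulate λ i → tabulate λ j →
  (isYes (j Data.Fin.≟ succ6 i)) Data.Bool.∨ (isYes (i Data.Fin.≟ succ6 j))
  where open import Relation.Nullary.Decidable using (isYes)

ExC6 : (n : ℕ) → Matrix n → Set
ExC6 n M = IsSimple M × ¬ IsMinor C6 M

NumberOf : ∀ {n} → (Matrix n → Set) → ℕ → Set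
NumberOf {n} P t = Σ (List (Matrix n)) λ L → Unique L × length L ≡ t × (∀ M → (M ∈ L) ⇔ P M)

-- integer surrogates for log n and log log log n
L1 : ℕ → ℕ
L1 n = ⌊log₂ n ⌋

L3 : ℕ → ℕ
L3 n = ⌊log₂ ⌊log₂ ⌊log₂ n ⌋ ⌋ ⌋

{-# OPTIONS --safe #-}
module Submission where

-- A graph has a C₆ minor iff it has a cycle with at least six vertices.  Let v have large degree in
-- such a minor-free G.  In a component of G − v, two neighbours of v are joined by paths with at most
-- three edges only, so a positive fraction of the neighbours in that component are adjacent to a common
-- vertex c, and up to finitely many exceptions each of them is the only neighbour of v in its component
-- of G − v − c.  So G contains q anchors c₁, …, c_q with r₁, …, r_q leaves, where m = q + Σ rᵢ is of the
-- order of deg v.  Re-hang everything along a single chain: after v comes an anchor, then its leaves, to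
-- the last of which the next component is attached in place of v, and so on.  Moving a part of a graph
-- from one cut vertex to another creates no long cycle, so the result is in the class.  All paths between
-- the two ends of the chain pass through it in order, so the chain is one of n² 3^(2m+1) candidates
-- given the result, and the chain determines G.  There are q! ∏ rᵢ! ways to order the chain, which
-- exceeds k n² 3^(2m+1) as soon as m is a large multiple of log n / log log log n.

open import Defs
open import Data.Nat using (ℕ; zero; suc; _+_; _*_; _∸_; _^_; _⊔_; _≤_; _<_; z≤n; s≤s; _≤?_; _!; _/_; _%_; ⌊_/2⌋; ⌈_/2⌉; NonZero; >-nonZero)
open import Data.Nat.DivMod using (m≡m%n+[m/n]*n; m%n<n; m/n*n≤m; /-monoˡ-≤)
open import Data.Nat.Induction using (<-rec)
open import Data.Nat.ListAction using (sum)
open import Data.Nat.Logarithm using (⌊log₂_⌋; ⌊log₂⌋-mono-≤; ⌊log₂⌊n/2⌋⌋≡⌊log₂n⌋∸1; ⌊log₂[2^n]⌋≡n)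
open import Data.Nat.Properties hiding (_≟_)
open import Data.Nat.Tactic.RingSolver using (solve-∀)
open import Data.Bool using (Bool; true; false; if_then_else_; _∨_)
import Data.Bool.Properties as Boolₚ
open import Data.Fin using (Fin; zero; suc; toℕ; _≟_)
open import Data.Fin.Patterns using (0F; 1F; 2F; 3F; 4F; 5F)
import Data.Fin.Properties as Finₚ
open import Data.Vec using (Vec; lookup; tabulate; toList)
import Data.Vec.Properties as Vecₚ
open import Data.List using (List; []; _∷_; _++_; length; map; concatMap; foldr; filter; reverse; take; allFin; replicate)
import Data.List.Properties as Listₚ
open import Data.List.Membership.Propositional using (_∈_; _∉_; find)
import Data.List.Membership.Propositional.Properties as ∈ₚ
open import Data.List.Relation.Binary.Permutation.Propositional using (_↭_; ↭-refl; ↭-trans; ↭-reflexive; module _↭_)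
open import Data.List.Relation.Binary.Permutation.Propositional.Properties using (++-comm; ↭-length; All-resp-↭; ↭-map-inv)
open import Data.List.Relation.Binary.Pointwise using (Pointwise; []; _∷_; Pointwise-length)
open import Data.List.Relation.Binary.Sublist.Propositional using (_⊆_; []; _∷_; _∷ʳ_; minimum)
import Data.List.Relation.Binary.Sublist.Propositional.Properties as Sublistₚ
open import Data.List.Relation.Unary.All using (All; []; _∷_)
import Data.List.Relation.Unary.All as All
import Data.List.Relation.Unary.All.Properties as Allₚ
open import Data.List.Relation.Unary.AllPairs using (AllPairs; []; _∷_)
import Data.List.Relation.Unary.AllPairs as AllPairs
import Data.List.Relation.Unary.AllPairs.Properties as AllPairsₚ
open import Data.List.Relation.Unary.Any using (here; there)
import Data.List.Relation.Unary.Any as Any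
import Data.List.Relation.Unary.Any.Properties as Anyₚ
open import Data.List.Relation.Unary.Unique.Propositional using (Unique)
import Data.List.Relation.Unary.Unique.Propositional.Properties as Uniqueₚ
open import Data.Maybe using (Maybe; just; nothing)
import Data.Maybe.Properties as Maybeₚ
open import Data.Product using (∃; ∃₂; ∃-syntax; _×_; _,_; proj₁; proj₂)
open import Data.Sum using (_⊎_; inj₁; inj₂)
open import Data.Empty using (⊥; ⊥-elim)
open import Function using (_∘_; id; case_of_)
open import Function.Bundles using (Equivalence)
open import Relation.Nullary using (¬_; Dec; yes; no; contradiction; does; ¬¬-excluded-middle)
open import Relation.Nullary.Decidable using (¬?; _×-dec_; _⊎-dec_; decidable-stable)
open import Relation.Binary.PropositionalEquality using (_≡_; _≢_; refl; sym; trans; cong; cong₂; subst; ≢-sym; module ≡-Reasoning)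

-- Why log log log n: the logarithm of q! ∏ rᵢ! has to beat a constant times m + log n. If all rᵢ
-- are about r, it is about q log q + m log r. Many anchors with few leaves favour the first term,
-- few anchors with many leaves the second. The worst case is r near log q, where the sum is only of
-- order m log log m. So the gain per vertex of the chain is log log m, and for m near log n this is
-- log log log n.
--
-- Why a chain: naming the m moved vertices one by one would cost a factor n each and destroy the
-- gain. On the chain the new graph itself displays them, and a path between the ends only needs one
-- of three symbols per vertex. Such a path must be short, so in every star one neighbour of v is
-- held back from the leaves: it keeps the anchor within two steps of the preceding vertex of the
-- chain. The sets of vertices that move are not recorded either, since connectivity determines
-- them.

false≢true : ∀ {b} → b ≡ false → b ≢ true
false≢true refl ()

≢true⇒false : ∀ {b} → b ≢ true → b ≡ false
≢true⇒false {false} _ = refl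
≢true⇒false {true}  h = contradiction refl h

true⊎false : ∀ b → b ≡ true ⊎ b ≡ false
true⊎false true  = inj₁ refl
true⊎false false = inj₂ refl

bool-cong : ∀ {a b} → (a ≡ true → b ≡ true) → (b ≡ true → a ≡ true) → a ≡ b
bool-cong {true}          f g = sym (f refl)
bool-cong {false} {true}  f g = g refl
bool-cong {false} {false} f g = refl

all-reverse : ∀ {A : Set} {P : A → Set} {xs} → All P xs → All P (reverse xs)
all-reverse ps = All.tabulate (All.lookup ps ∘ Anyₚ.reverse⁻)

unique-++ˡ : ∀ {A : Set} (as : List A) {bs} → Unique (as ++ bs) → Unique as
unique-++ˡ []       _       = []
unique-++ˡ (_ ∷ as) (a ∷ u) = Allₚ.++⁻ˡ as a ∷ unique-++ˡ as u

unique-++ʳ : ∀ {A : Set} (as : List A) {bs} → Unique (as ++ bs) → Unique bs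
unique-++ʳ []       u       = u
unique-++ʳ (_ ∷ as) (_ ∷ u) = unique-++ʳ as u

-- Graphs as adjacency functions, paths as vertex lists

Graph : ℕ → Set
Graph n = Fin n → Fin n → Bool

adj : ∀ {n} → Matrix n → Graph n
adj M i j = lookup (lookup M i) j

data Path {n} (E : Graph n) : Fin n → List (Fin n) → Fin n → Set where
  stop : ∀ {x} → Path E x (x ∷ []) x
  _∷_  : ∀ {x y xs z} → E x y ≡ true → Path E y xs z → Path E x (x ∷ xs) z

-- A cycle is encoded as a repetition-free path whose last vertex is adjacent to its first. A
-- surgery then only has to carry over one path and one closing edge.
NoLongCycle : ∀ {n} → Graph n → Set
NoLongCycle E = ∀ {x xs y} → Path E x xs y → Unique xs → E y x ≡ true → ¬ 6 ≤ length xs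

record Simple {n} (E : Graph n) : Set where
  field
    symm    : ∀ x y → E x y ≡ E y x
    irrefl  : ∀ x → E x x ≡ false

  adj-sym : ∀ {x y} → E x y ≡ true → E y x ≡ true
  adj-sym {x} {y} e = trans (symm y x) e

  adj⇒≢ : ∀ {x y} → E x y ≡ true → x ≢ y
  adj⇒≢ {x} e refl = case trans (sym (irrefl x)) e of λ ()

module _ {n} {E : Graph n} where

  path-join : ∀ {x xs y z ys w} → Path E x xs y → E y z ≡ true → Path E z ys w → Path E x (xs ++ ys) w
  path-join stop    e q = e ∷ q
  path-join (d ∷ p) e q = d ∷ path-join p e q

  path-reverse : Simple E → ∀ {x xs y} → Path E x xs y → Path E y (reverse xs) x
  path-reverse S stop = stop
  path-reverse S (_∷_ {x} {y} {xs} e p) =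
    subst (λ l → Path E _ l _) (sym (Listₚ.unfold-reverse x xs))
      (path-join (path-reverse S p) (Simple.adj-sym S e) stop)

  source∈ : ∀ {x xs y} → Path E x xs y → x ∈ xs
  source∈ stop    = here refl
  source∈ (_ ∷ _) = here refl

  target∈ : ∀ {x xs y} → Path E x xs y → y ∈ xs
  target∈ stop    = here refl
  target∈ (_ ∷ p) = there (target∈ p)

  path-suffix : ∀ {x xs y z} → Path E x xs y → z ∈ xs → ∃₂ λ as bs → xs ≡ as ++ bs × Path E z bs y
  path-suffix stop    (here refl) = [] , _ , refl , stop
  path-suffix (e ∷ p) (here refl) = [] , _ , refl , e ∷ p
  path-suffix (e ∷ p) (there i) with path-suffix p i
  ... | as , bs , refl , q = _ ∷ as , bs , refl , q

  path-prefix : ∀ {x xs y z} → Path E x xs y → z ∈ xs → ∃₂ λ as bs → xs ≡ as ++ bs × Path E x as z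
  path-prefix stop    (here refl) = _ , [] , refl , stop
  path-prefix (e ∷ p) (here refl) = _ , _ , refl , stop
  path-prefix (e ∷ p) (there i) with path-prefix p i
  ... | as , bs , refl , q = _ ∷ as , bs , refl , e ∷ q

  simplePath : ∀ {P : Fin n → Set} {x xs y} → Path E x xs y → All P xs →
               ∃ λ ys → Path E x ys y × Unique ys × All P ys
  simplePath stop (px ∷ []) = _ , stop , [] ∷ [] , px ∷ []
  simplePath (_∷_ {x} e p) (px ∷ ps) with simplePath p ps
  ... | ys , q , u , qs with Any.any? (x ≟_) ys
  ...   | no x∉ys  = x ∷ ys , e ∷ q , Allₚ.¬Any⇒All¬ _ x∉ys ∷ u , px ∷ qs
  ...   | yes x∈ys with path-suffix q x∈ys
  ...     | as , bs , refl , q′ = bs , q′ , unique-++ʳ as u , Allₚ.++⁻ʳ as qs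

module _ {n} {E F : Graph n} where

  path-map : (∀ x y → E x y ≡ true → F x y ≡ true) → ∀ {x xs y} → Path E x xs y → Path F x xs y
  path-map h stop    = stop
  path-map h (e ∷ p) = h _ _ e ∷ path-map h p

  path-mono : ∀ {P : Fin n → Set} → (∀ {x y} → P x → P y → E x y ≡ true → F x y ≡ true) →
              ∀ {x xs y} → Path E x xs y → All P xs → Path F x xs y
  path-mono h stop _ = stop
  path-mono h (e ∷ stop) (px ∷ py ∷ []) = h px py e ∷ stop
  path-mono h (e ∷ p@(_ ∷ _)) (px ∷ ps@(py ∷ _)) = h px py e ∷ path-mono h p ps

-- Long cycles and minors

walk⇒path : ∀ {n} {M : Matrix n} {P : Fin n → Set} {x y} → Walk M P x y →
            ∃ λ xs → Path (adj M) x xs y × All P xs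
walk⇒path [ px ]        = _ , stop , px ∷ []
walk⇒path (step px e w) with walk⇒path w
... | xs , p , ps = _ , e ∷ p , px ∷ ps

path⇒walk : ∀ {n} {M : Matrix n} {P : Fin n → Set} {x xs y} → Path (adj M) x xs y → All P xs → Walk M P x y
path⇒walk stop    (px ∷ _)  = [ px ]
path⇒walk (e ∷ p) (px ∷ ps) = step px e (path⇒walk p ps)

module _ {n} {G : Matrix n} where

  -- Choose a graph edge for each edge of the hexagon, and inside each branch set a simple path from
  -- the entering to the leaving vertex. The six paths and six edges close up to a cycle with at
  -- least one vertex per branch set.
  noLongCycle⇒noMinor : NoLongCycle (adj G) → ¬ IsMinor C6 G
  noLongCycle⇒noMinor noLong (β , _ , conn , edge) =
    noLong (path c₅) (unique c₅) (out→inn 5F) (long c₅)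
    where
    inn out : Fin 6 → Fin n
    step-edge : ∀ h → Adj C6 h (succ6 h)
    step-edge 0F = refl
    step-edge 1F = refl
    step-edge 2F = refl
    step-edge 3F = refl
    step-edge 4F = refl
    step-edge 5F = refl
    pred6 : Fin 6 → Fin 6
    pred6 0F = 5F
    pred6 1F = 0F
    pred6 2F = 1F
    pred6 3F = 2F
    pred6 4F = 3F
    pred6 5F = 4F
    succ-pred : ∀ h → succ6 (pred6 h) ≡ h
    succ-pred 0F = refl
    succ-pred 1F = refl
    succ-pred 2F = refl
    succ-pred 3F = refl
    succ-pred 4F = refl
    succ-pred 5F = refl
    pred-succ : ∀ h → pred6 (succ6 h) ≡ h
    pred-succ 0F = refl
    pred-succ 1F = refl
    pred-succ 2F = refl
    pred-succ 3F = refl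
    pred-succ 4F = refl
    pred-succ 5F = refl
    link : ∀ h → ∃[ u ] ∃[ v ] (β u ≡ just h × β v ≡ just (succ6 h) × Adj G u v)
    link h = edge h (succ6 h) (step-edge h)
    out h = proj₁ (link h)
    inn h = proj₁ (proj₂ (link (pred6 h)))
    β-out : ∀ h → β (out h) ≡ just h
    β-out h = proj₁ (proj₂ (proj₂ (link h)))
    β-inn : ∀ h → β (inn h) ≡ just h
    β-inn h = trans (proj₁ (proj₂ (proj₂ (proj₂ (link (pred6 h)))))) (cong just (succ-pred h))
    out→inn : ∀ h → adj G (out h) (inn (succ6 h)) ≡ true
    out→inn h = subst (λ k → adj G (out h) (proj₁ (proj₂ (link k))) ≡ true) (sym (pred-succ h))
                  (proj₂ (proj₂ (proj₂ (proj₂ (link h)))))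

    record Chain (k : Fin 6) : Set where
      field
        {verts} : List (Fin n)
        path    : Path (adj G) (inn 0F) verts (out k)
        unique  : Unique verts
        -- The bound on the branch index is what separates the next segment from all earlier ones.
        inside  : All (λ v → ∃ λ h → β v ≡ just h × toℕ h ≤ toℕ k) verts
        long    : suc (toℕ k) ≤ length verts
    open Chain

    branch : ∀ h → ∃ λ xs → Path (adj G) (inn h) xs (out h) × Unique xs × All (λ v → β v ≡ just h) xs
    branch h with walk⇒path (conn h _ _ (β-inn h) (β-out h))
    ... | xs , p , ps = simplePath p ps

    extend : ∀ k → toℕ (succ6 k) ≡ suc (toℕ k) → Chain k → Chain (succ6 k)
    extend k eq c with branch (succ6 k)
    ... | xs , p , u , ps = record
      { path   = path-join (path c) (out→inn k) p
      ; unique = Uniqueₚ.++⁺ (unique c) u disj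
      ; inside = Allₚ.++⁺ (All.map (λ (h , e , l) → h , e , ≤-trans l (≤-trans (n≤1+n _) (≤-reflexive (sym eq)))) (inside c))
                          (All.map (λ e → _ , e , ≤-refl) ps)
      ; long   = subst (suc (toℕ (succ6 k)) ≤_) (sym (Listₚ.length-++ (verts c)))
                   (≤-trans (≤-reflexive (trans (cong suc eq) (+-comm 1 _))) (+-mono-≤ (long c) (∈ₚ.∈-length (source∈ p))))
      }
      where
      disj : ∀ {v} → ¬ (v ∈ verts c × v ∈ xs)
      disj (i , j) with All.lookup (inside c) i
      ... | h , e , l with Maybeₚ.just-injective (trans (sym e) (All.lookup ps j))
      ...   | refl = <-irrefl refl (≤-trans (≤-reflexive (sym eq)) l)

    c₀ : Chain 0F
    c₀ with branch 0F
    ... | xs , p , u , ps = record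
      { path = p ; unique = u ; inside = All.map (λ e → _ , e , ≤-refl) ps ; long = ∈ₚ.∈-length (source∈ p) }

    c₅ : Chain 5F
    c₅ = extend 4F refl (extend 3F refl (extend 2F refl (extend 1F refl (extend 0F refl c₀))))

  -- The first five vertices of a long cycle serve as singleton branch sets, and all remaining ones
  -- together form the sixth.
  noMinor⇒noLongCycle : Simple (adj G) → ¬ IsMinor C6 G → NoLongCycle (adj G)
  noMinor⇒noLongCycle S noMinor
    {x₀} {_ ∷ x₁ ∷ x₂ ∷ x₃ ∷ x₄ ∷ x₅ ∷ xs} {y} (e₀ ∷ e₁ ∷ e₂ ∷ e₃ ∷ e₄ ∷ p)
    ((n₀₁ ∷ n₀₂ ∷ n₀₃ ∷ n₀₄ ∷ n₀) ∷ (n₁₂ ∷ n₁₃ ∷ n₁₄ ∷ n₁) ∷ (n₂₃ ∷ n₂₄ ∷ n₂) ∷ (n₃₄ ∷ n₃) ∷ n₄ ∷ _) close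
    (s≤s (s≤s (s≤s (s≤s (s≤s _))))) = noMinor (β , (λ h → _ , hit h) , connected , edges)
    where
    open Simple S
    tail = x₅ ∷ xs
    β : Fin n → Maybe (Fin 6)
    β v with v ≟ x₀ | v ≟ x₁ | v ≟ x₂ | v ≟ x₃ | v ≟ x₄ | Any.any? (v ≟_) tail
    ... | yes _ | _     | _     | _     | _     | _     = just 0F
    ... | no _  | yes _ | _     | _     | _     | _     = just 1F
    ... | no _  | no _  | yes _ | _     | _     | _     = just 2F
    ... | no _  | no _  | no _  | yes _ | _     | _     = just 3F
    ... | no _  | no _  | no _  | no _  | yes _ | _     = just 4F
    ... | no _  | no _  | no _  | no _  | no _  | yes _ = just 5F
    ... | no _  | no _  | no _  | no _  | no _  | no _  = nothing

    Class : Fin 6 → Fin n → Set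
    Class 0F v = v ≡ x₀
    Class 1F v = v ≡ x₁
    Class 2F v = v ≡ x₂
    Class 3F v = v ≡ x₃
    Class 4F v = v ≡ x₄
    Class 5F v = v ∈ tail

    β⇒Class : ∀ v h → β v ≡ just h → Class h v
    β⇒Class v h eq with v ≟ x₀ | v ≟ x₁ | v ≟ x₂ | v ≟ x₃ | v ≟ x₄ | Any.any? (v ≟_) tail
    β⇒Class v _ refl | yes q | _     | _     | _     | _     | _     = q
    β⇒Class v _ refl | no _  | yes q | _     | _     | _     | _     = q
    β⇒Class v _ refl | no _  | no _  | yes q | _     | _     | _     = q
    β⇒Class v _ refl | no _  | no _  | no _  | yes q | _     | _     = q
    β⇒Class v _ refl | no _  | no _  | no _  | no _  | yes q | _     = q
    β⇒Class v _ refl | no _  | no _  | no _  | no _  | no _  | yes q = q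

    Class⇒β : ∀ v h → Class h v → β v ≡ just h
    Class⇒β v h q with v ≟ x₀ | v ≟ x₁ | v ≟ x₂ | v ≟ x₃ | v ≟ x₄ | Any.any? (v ≟_) tail
    Class⇒β v 0F q    | yes _ | _ | _ | _ | _ | _ = refl
    Class⇒β v 0F q    | no a  | _ | _ | _ | _ | _ = contradiction q a
    Class⇒β v 1F refl | yes b | _ | _ | _ | _ | _ = contradiction (sym b) n₀₁
    Class⇒β v 1F q    | no _  | yes _ | _ | _ | _ | _ = refl
    Class⇒β v 1F q    | no _  | no a  | _ | _ | _ | _ = contradiction q a
    Class⇒β v 2F refl | yes b | _ | _ | _ | _ | _ = contradiction (sym b) n₀₂
    Class⇒β v 2F refl | no _  | yes b | _ | _ | _ | _ = contradiction (sym b) n₁₂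
    Class⇒β v 2F q    | no _  | no _  | yes _ | _ | _ | _ = refl
    Class⇒β v 2F q    | no _  | no _  | no a  | _ | _ | _ = contradiction q a
    Class⇒β v 3F refl | yes b | _ | _ | _ | _ | _ = contradiction (sym b) n₀₃
    Class⇒β v 3F refl | no _  | yes b | _ | _ | _ | _ = contradiction (sym b) n₁₃
    Class⇒β v 3F refl | no _  | no _  | yes b | _ | _ | _ = contradiction (sym b) n₂₃
    Class⇒β v 3F q    | no _  | no _  | no _  | yes _ | _ | _ = refl
    Class⇒β v 3F q    | no _  | no _  | no _  | no a  | _ | _ = contradiction q a
    Class⇒β v 4F refl | yes b | _ | _ | _ | _ | _ = contradiction (sym b) n₀₄
    Class⇒β v 4F refl | no _  | yes b | _ | _ | _ | _ = contradiction (sym b) n₁₄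
    Class⇒β v 4F refl | no _  | no _  | yes b | _ | _ | _ = contradiction (sym b) n₂₄
    Class⇒β v 4F refl | no _  | no _  | no _  | yes b | _ | _ = contradiction (sym b) n₃₄
    Class⇒β v 4F q    | no _  | no _  | no _  | no _  | yes _ | _ = refl
    Class⇒β v 4F q    | no _  | no _  | no _  | no _  | no a  | _ = contradiction q a
    Class⇒β v 5F q    | yes b | _ | _ | _ | _ | _ = contradiction (sym b) (All.lookup n₀ q)
    Class⇒β v 5F q    | no _  | yes b | _ | _ | _ | _ = contradiction (sym b) (All.lookup n₁ q)
    Class⇒β v 5F q    | no _  | no _  | yes b | _ | _ | _ = contradiction (sym b) (All.lookup n₂ q)
    Class⇒β v 5F q    | no _  | no _  | no _  | yes b | _ | _ = contradiction (sym b) (All.lookup n₃ q)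
    Class⇒β v 5F q    | no _  | no _  | no _  | no _  | yes b | _ = contradiction (sym b) (All.lookup n₄ q)
    Class⇒β v 5F q    | no _  | no _  | no _  | no _  | no _  | yes _ = refl
    Class⇒β v 5F q    | no _  | no _  | no _  | no _  | no _  | no a  = contradiction q a

    rep : Fin 6 → Fin n
    rep 0F = x₀
    rep 1F = x₁
    rep 2F = x₂
    rep 3F = x₃
    rep 4F = x₄
    rep 5F = x₅

    hit : ∀ h → β (rep h) ≡ just h
    hit 0F = Class⇒β _ 0F refl
    hit 1F = Class⇒β _ 1F refl
    hit 2F = Class⇒β _ 2F refl
    hit 3F = Class⇒β _ 3F refl
    hit 4F = Class⇒β _ 4F refl
    hit 5F = Class⇒β _ 5F (here refl)

    walkTo : ∀ {z zs w} → Path (adj G) z zs w → All (_∈ tail) zs → Walk G (λ v → β v ≡ just 5F) z w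
    walkTo q qs = path⇒walk q (All.map (Class⇒β _ 5F) qs)

    target = target∈ p

    toEnd : ∀ u → u ∈ tail → ∃ λ zs → Path (adj G) u zs y × All (_∈ tail) zs
    toEnd u i with path-suffix p i
    ... | as , bs , eq , q = bs , q , All.tabulate λ j → subst (_ ∈_) (sym eq) (∈ₚ.∈-++⁺ʳ as j)

    single : ∀ {h w} → (∀ v → Class h v → v ≡ w) → ∀ u v → β u ≡ just h → β v ≡ just h → Walk G (λ x → β x ≡ just h) u v
    single {h} only u v p q with only u (β⇒Class u h p) | only v (β⇒Class v h q)
    ... | refl | refl = [ p ]

    connected : ∀ h u v → β u ≡ just h → β v ≡ just h → Walk G (λ x → β x ≡ just h) u v
    connected 0F = single {0F} λ _ q → q
    connected 1F = single {1F} λ _ q → q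
    connected 2F = single {2F} λ _ q → q
    connected 3F = single {3F} λ _ q → q
    connected 4F = single {4F} λ _ q → q
    -- Two vertices of the sixth branch set are joined through its last vertex `y`: forward to `y`
    -- from the one, then backward to the other.
    connected 5F u v p q with toEnd u (β⇒Class u 5F p) | toEnd v (β⇒Class v 5F q)
    ... | _ ∷ _ , r , rs | as , r′ , rs′ = glue r rs (reverse as) (path-reverse S r′) (all-reverse rs′)
      where
      glue : ∀ {a zs b} → Path (adj G) a zs y → All (_∈ tail) zs → ∀ ws → Path (adj G) y ws b → All (_∈ tail) ws →
             Walk G (λ x → β x ≡ just 5F) a b
      glue stop (i ∷ _) ws q qs = walkTo q qs
      glue (e ∷ r) (i ∷ is) ws q qs = step (Class⇒β _ 5F i) e (glue r is ws q qs)

    Edge : Fin 6 → Fin 6 → Set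
    Edge h h′ = ∃[ u ] ∃[ v ] (β u ≡ just h × β v ≡ just h′ × Adj G u v)

    flip-edge : ∀ {h h′} → Edge h h′ → Edge h′ h
    flip-edge (u , v , p , q , e) = v , u , q , p , adj-sym e

    closing : Edge 5F 0F
    closing = y , x₀ , Class⇒β _ 5F target , hit 0F , close

    edges : ∀ h h′ → Adj C6 h h′ → Edge h h′
    edges 0F 1F _ = _ , _ , hit 0F , hit 1F , e₀
    edges 1F 2F _ = _ , _ , hit 1F , hit 2F , e₁
    edges 2F 3F _ = _ , _ , hit 2F , hit 3F , e₂
    edges 3F 4F _ = _ , _ , hit 3F , hit 4F , e₃
    edges 4F 5F _ = _ , _ , hit 4F , Class⇒β _ 5F (source∈ p) , e₄
    edges 5F 0F _ = closing
    edges 1F 0F _ = flip-edge (_ , _ , hit 0F , hit 1F , e₀)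
    edges 2F 1F _ = flip-edge (_ , _ , hit 1F , hit 2F , e₁)
    edges 3F 2F _ = flip-edge (_ , _ , hit 2F , hit 3F , e₂)
    edges 4F 3F _ = flip-edge (_ , _ , hit 3F , hit 4F , e₃)
    edges 5F 4F _ = flip-edge (_ , _ , hit 4F , Class⇒β _ 5F (source∈ p) , e₄)
    edges 0F 5F _ = flip-edge closing
    edges 0F 0F ()
    edges 0F 2F ()
    edges 0F 3F ()
    edges 0F 4F ()
    edges 1F 1F ()
    edges 1F 3F ()
    edges 1F 4F ()
    edges 1F 5F ()
    edges 2F 0F ()
    edges 2F 2F ()
    edges 2F 4F ()
    edges 2F 5F ()
    edges 3F 0F ()
    edges 3F 1F ()
    edges 3F 3F ()
    edges 3F 5F ()
    edges 4F 0F ()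
    edges 4F 1F ()
    edges 4F 2F ()
    edges 4F 4F ()
    edges 5F 1F ()
    edges 5F 2F ()
    edges 5F 3F ()
    edges 5F 5F ()

-- Sliding a part of the graph from one cut vertex to another

VSet : ℕ → Set
VSet n = Fin n → Bool

subgraph-noLongCycle : ∀ {n} {E F : Graph n} → (∀ x y → F x y ≡ true → E x y ≡ true) → NoLongCycle E → NoLongCycle F
subgraph-noLongCycle F⊆E noLong p u e = noLong (path-map F⊆E p) u (F⊆E _ _ e)

module _ {n} (p c : Fin n) where

  transpose : Fin n → Fin n
  transpose x with x ≟ p | x ≟ c
  ... | yes _ | _     = c
  ... | no _  | yes _ = p
  ... | no _  | no _  = x

  transpose-p : transpose p ≡ c
  transpose-p with p ≟ p
  ... | yes _ = refl
  ... | no ¬q = contradiction refl ¬q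

  transpose-c : transpose c ≡ p
  transpose-c with c ≟ p | c ≟ c
  ... | yes q | _     = q
  ... | no _  | yes _ = refl
  ... | no _  | no ¬q = contradiction refl ¬q

  transpose-other : ∀ {x} → x ≢ p → x ≢ c → transpose x ≡ x
  transpose-other {x} x≢p x≢c with x ≟ p | x ≟ c
  ... | yes q | _     = contradiction q x≢p
  ... | no _  | yes q = contradiction q x≢c
  ... | no _  | no _  = refl

  transpose-involutive : ∀ x → transpose (transpose x) ≡ x
  transpose-involutive x with x ≟ p | x ≟ c
  ... | yes refl | _        = transpose-c
  ... | no _     | yes refl = transpose-p
  ... | no x≢p   | no x≢c   = transpose-other x≢p x≢c

  transpose-injective : ∀ {x y} → transpose x ≡ transpose y → x ≡ y
  transpose-injective {x} {y} eq =
    trans (sym (transpose-involutive x)) (trans (cong transpose eq) (transpose-involutive y))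

  -- Only pairs with exactly one end in `R` are affected. If `p` is the only exit from `R`, this
  -- takes `R` off `p` and hangs it on `c`. Exchanging `p` and `c`, instead of just redirecting
  -- edges, makes the operation its own inverse.
  slide : VSet n → Graph n → Graph n
  slide R E x y with R x Boolₚ.≟ R y
  ... | yes _ = E x y
  ... | no _  = E (transpose x) (transpose y)

  slide-same : ∀ {R} E {x y} → R x ≡ R y → slide R E x y ≡ E x y
  slide-same {R} E {x} {y} eq with R x Boolₚ.≟ R y
  ... | yes _ = refl
  ... | no ¬q = contradiction eq ¬q

  slide-cross : ∀ {R} E {x y} → R x ≢ R y → slide R E x y ≡ E (transpose x) (transpose y)
  slide-cross {R} E {x} {y} ne with R x Boolₚ.≟ R y
  ... | yes q = contradiction q ne
  ... | no _  = refl

  slide-simple : ∀ {R E} → Simple E → Simple (slide R E)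
  slide-simple {R} {E} S = record { symm = symm′ ; irrefl = λ x → trans (slide-same {R} E refl) (irrefl x) }
    where
    open Simple S
    symm′ : ∀ x y → slide R E x y ≡ slide R E y x
    symm′ x y with R x Boolₚ.≟ R y | R y Boolₚ.≟ R x
    ... | yes _ | yes _ = symm x y
    ... | no _  | no _  = symm _ _
    ... | yes q | no ¬q = contradiction (sym q) ¬q
    ... | no ¬q | yes q = contradiction (sym q) ¬q

  module _ {R : VSet n} (Rp : R p ≡ false) (Rc : R c ≡ false) where

    R-transpose : ∀ x → R (transpose x) ≡ R x
    R-transpose x with x ≟ p | x ≟ c
    ... | yes refl | _        = trans Rc (sym Rp)
    ... | no _     | yes refl = trans Rp (sym Rc)
    ... | no _     | no _     = refl

    transpose-in : ∀ {x} → R x ≡ true → transpose x ≡ x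
    transpose-in {x} Rx = transpose-other (λ { refl → false≢true Rp Rx }) (λ { refl → false≢true Rc Rx })

    slide-involutive : ∀ E x y → slide R (slide R E) x y ≡ E x y
    slide-involutive E x y with R x Boolₚ.≟ R y
    ... | yes q = slide-same {R} E q
    ... | no ¬q = trans (slide-cross {R} E (λ q → ¬q (trans (sym (R-transpose x)) (trans q (R-transpose y)))))
                        (cong₂ E (transpose-involutive x) (transpose-involutive y))

    module _ {E : Graph n} (closed : ∀ {x y} → R x ≡ true → E x y ≡ true → R y ≡ true ⊎ y ≡ p) where

      slide-leave : ∀ {x y} → R x ≡ true → R y ≡ false → slide R E x y ≡ true → y ≡ c × E x p ≡ true
      slide-leave {x} {y} Rx Ry e with
        trans (sym (slide-cross {R} E {x} {y} (λ q → false≢true Ry (trans (sym q) Rx)))) e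
      ... | e′ with closed (trans (R-transpose x) Rx) e′
      ...   | inj₁ Ry′ = contradiction (trans (sym (R-transpose y)) Ry′) (false≢true Ry)
      ...   | inj₂ q   = trans (sym (transpose-involutive y)) (trans (cong transpose q) transpose-p)
                       , subst (λ z → E z p ≡ true) (transpose-in Rx) (subst (λ z → E _ z ≡ true) q e′)

AllPairs-resp-↭ : ∀ {A : Set} {R : A → A → Set} → (∀ {x y} → R x y → R y x) →
                  ∀ {xs ys} → xs ↭ ys → AllPairs R xs → AllPairs R ys
AllPairs-resp-↭ s _↭_.refl ps = ps
AllPairs-resp-↭ s (_↭_.prep x σ) (p ∷ ps) = All-resp-↭ σ p ∷ AllPairs-resp-↭ s σ ps
AllPairs-resp-↭ s (_↭_.swap x y σ) ((p ∷ ps) ∷ qs ∷ rs) = (s p ∷ All-resp-↭ σ qs) ∷ All-resp-↭ σ ps ∷ AllPairs-resp-↭ s σ rs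
AllPairs-resp-↭ s (_↭_.trans σ τ) ps = AllPairs-resp-↭ s τ (AllPairs-resp-↭ s σ ps)

path-split : ∀ {n} {E : Graph n} {x xs y z} → Path E x xs y → z ∈ xs →
             z ≡ x ⊎ ∃₂ λ as bs → ∃ λ w → Path E x as w × E w z ≡ true × Path E z bs y × xs ≡ as ++ bs
path-split stop    (here q) = inj₁ q
path-split (_ ∷ _) (here q) = inj₁ q
path-split (e ∷ p) (there i) with path-split p i
... | inj₁ refl = inj₂ (_ , _ , _ , stop , e , p , refl)
... | inj₂ (as , bs , w , q , d , r , refl) = inj₂ (_ ∷ as , bs , w , e ∷ q , d , r , refl)

cycle-rotate : ∀ {n} {E : Graph n} {x xs y z} → Path E x xs y → E y x ≡ true → z ∈ xs →
               ∃₂ λ ys w → Path E z ys w × E w z ≡ true × xs ↭ ys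
cycle-rotate p e i with path-split p i
... | inj₁ refl = _ , _ , p , e , ↭-refl
... | inj₂ (as , bs , w , q , d , r , refl) = bs ++ as , w , path-join r e q , d , ++-comm as bs

module _ {n} (p c : Fin n) {R : VSet n} (Rp : R p ≡ false) (Rc : R c ≡ false) {E : Graph n} (S : Simple E)
         (closed : ∀ {x y} → R x ≡ true → E x y ≡ true → R y ≡ true ⊎ y ≡ p) where

  private
    E′ = slide p c R E
    S′ : Simple E′
    S′ = slide-simple p c {R} S

    -- By `slide-leave` an edge that leaves `R` in the new graph ends at `c`, so away from `c` no
    -- edge crosses the border of `R`.
    same-side : ∀ {x y} → x ≢ c → y ≢ c → E′ x y ≡ true → R x ≡ R y
    same-side x≢c y≢c e = bool-cong (one-way y≢c e) (one-way x≢c (Simple.adj-sym S′ e))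
      where
      one-way : ∀ {x y} → y ≢ c → E′ x y ≡ true → R x ≡ true → R y ≡ true
      one-way {y = y} y≢c e Rx with true⊎false (R y)
      ... | inj₁ Ry = Ry
      ... | inj₂ Ry = contradiction (proj₁ (slide-leave p c Rp Rc closed Rx Ry e)) y≢c

    same-side-path : ∀ {x xs y} → Path E′ x xs y → All (c ≢_) xs → All (λ z → R z ≡ R x) xs
    same-side-path stop _ = refl ∷ []
    same-side-path (e ∷ q) (c≢x ∷ c≢) = refl ∷ All.map (λ h → trans h (sym eq)) (same-side-path q c≢)
      where eq = same-side (≢-sym c≢x) (≢-sym (All.lookup c≢ (source∈ q))) e

    Inside Outside : Fin n → Set
    Inside  z = R z ≡ true ⊎ z ≡ c
    Outside z = R z ≡ false

    dichotomy : ∀ {x xs y} → Path E′ x xs y → All (c ≢_) xs → All Inside xs ⊎ All Outside xs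
    dichotomy {x} q c≢ with true⊎false (R x)
    ... | inj₁ Rx = inj₁ (All.map (λ h → inj₁ (trans h Rx)) (same-side-path q c≢))
    ... | inj₂ Rx = inj₂ (All.map (λ h → trans h Rx) (same-side-path q c≢))

    dichotomy-from-c : ∀ {xs y} → Path E′ c xs y → Unique xs → All Inside xs ⊎ All Outside xs
    dichotomy-from-c stop _ = inj₂ (Rc ∷ [])
    dichotomy-from-c (_ ∷ q) (c≢ ∷ _) with dichotomy q c≢
    ... | inj₁ h = inj₁ (inj₂ refl ∷ h)
    ... | inj₂ h = inj₂ (Rc ∷ h)

    outside-edge : ∀ {x y} → Outside x → Outside y → E′ x y ≡ true → E x y ≡ true
    outside-edge ox oy e = trans (sym (slide-same p c {R} E (trans ox (sym oy)))) e

    inside-edge : ∀ {x y} → Inside x → Inside y → E′ x y ≡ true → E (transpose p c x) (transpose p c y) ≡ true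
    inside-edge {x} {y} ix iy e with R x Boolₚ.≟ R y
    inside-edge ix iy e | no _ = e
    inside-edge (inj₁ Rx) (inj₁ Ry) e | yes _ =
      trans (cong₂ E (transpose-in p c Rp Rc Rx) (transpose-in p c Rp Rc Ry)) e
    inside-edge (inj₁ Rx) (inj₂ refl) e | yes q = contradiction (trans (sym q) Rx) (false≢true Rc)
    inside-edge (inj₂ refl) (inj₁ Ry) e | yes q = contradiction (trans q Ry) (false≢true Rc)
    inside-edge (inj₂ refl) (inj₂ refl) e | yes _ = contradiction refl (Simple.adj⇒≢ S e)

    -- The exchange of `p` and `c` maps `R` with `c` in the new graph to `R` with `p` in the old
    -- one. A cycle found there is pulled back without loss of length.
    inside-path : ∀ {x xs y} → Path E′ x xs y → All Inside xs → Path E (transpose p c x) (map (transpose p c) xs) (transpose p c y)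
    inside-path stop _ = stop
    inside-path (e ∷ q) (ix ∷ is) = inside-edge ix (All.lookup is (source∈ q)) e ∷ inside-path q is

    shorten : NoLongCycle E → ∀ {x xs y} → Path E′ x xs y → Unique xs → E′ y x ≡ true → 6 ≤ length xs → All Inside xs ⊎ All Outside xs → ⊥
    shorten noLong {xs = xs} q u e long (inj₁ is) = noLong (inside-path q is) (Uniqueₚ.map⁺ (transpose-injective p c) u)
      (inside-edge (All.lookup is (target∈ q)) (All.lookup is (source∈ q)) e)
      (subst (6 ≤_) (sym (Listₚ.length-map (transpose p c) xs)) long)
    shorten noLong q u e long (inj₂ os) =
      noLong (path-mono outside-edge q os) u (outside-edge (All.lookup os (target∈ q)) (All.lookup os (source∈ q)) e) long

  -- A cycle of the new graph meets c at most once, so it lies in R ∪ {c} or avoids R.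
  slide-noLongCycle : NoLongCycle E → NoLongCycle E′
  slide-noLongCycle noLong {x} {xs} {y} q u e long with Any.any? (c ≟_) xs
  ... | no c∉ = shorten noLong q u e long (dichotomy q (Allₚ.¬Any⇒All¬ _ c∉))
  -- Opened at `c`, the rest of the cycle is a path avoiding `c`, and so lies entirely on one side.
  ... | yes c∈ with cycle-rotate q e c∈
  ...   | ys , w , r , d , xs↭ys = shorten noLong r u′ d (subst (6 ≤_) (↭-length xs↭ys) long) (dichotomy-from-c r u′)
    where
    u′ = AllPairs-resp-↭ ≢-sym xs↭ys u

-- Deleting the edges between p and a list of vertices

module _ {n} (p : Fin n) (us : List (Fin n)) where

  Cut : Fin n → Fin n → Set
  Cut x y = x ≡ p × y ∈ us

  cut? : ∀ x y → Dec (Cut x y ⊎ Cut y x)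
  cut? x y = ((x ≟ p) ×-dec Any.any? (y ≟_) us) ⊎-dec ((y ≟ p) ×-dec Any.any? (x ≟_) us)

  delete : Graph n → Graph n
  delete E x y with cut? x y
  ... | yes _ = false
  ... | no _  = E x y

  delete-keep : ∀ E {x y} → ¬ (Cut x y ⊎ Cut y x) → delete E x y ≡ E x y
  delete-keep E {x} {y} ¬q with cut? x y
  ... | yes q = contradiction q ¬q
  ... | no _  = refl

  delete-cut : ∀ E {x y} → Cut x y ⊎ Cut y x → delete E x y ≡ false
  delete-cut E {x} {y} q with cut? x y
  ... | yes _ = refl
  ... | no ¬q = contradiction q ¬q

  delete-⊆ : ∀ E x y → delete E x y ≡ true → E x y ≡ true
  delete-⊆ E x y e with cut? x y
  ... | no _ = e

  delete-simple : ∀ {E} → Simple E → Simple (delete E)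
  delete-simple {E} S = record { symm = symm′ ; irrefl = irrefl′ }
    where
    open Simple S
    symm′ : ∀ x y → delete E x y ≡ delete E y x
    symm′ x y with cut? x y | cut? y x
    ... | yes _ | yes _ = refl
    ... | no _  | no _  = symm x y
    ... | yes (inj₁ q) | no ¬q = contradiction (inj₂ q) ¬q
    ... | yes (inj₂ q) | no ¬q = contradiction (inj₁ q) ¬q
    ... | no ¬q | yes (inj₁ q) = contradiction (inj₂ q) ¬q
    ... | no ¬q | yes (inj₂ q) = contradiction (inj₁ q) ¬q
    irrefl′ : ∀ x → delete E x x ≡ false
    irrefl′ x with cut? x x
    ... | yes _ = refl
    ... | no _  = irrefl x

  -- All deleted edges were present beforehand, so `p` and `us` say exactly what to restore.
  delete-injective : ∀ {E F} → Simple E → Simple F → All (λ u → E p u ≡ true) us → All (λ u → F p u ≡ true) us →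
                     (∀ x y → delete E x y ≡ delete F x y) → ∀ x y → E x y ≡ F x y
  delete-injective {E} {F} SE SF Eu Fu eq x y with cut? x y
  ... | yes (inj₁ (refl , i)) = trans (All.lookup Eu i) (sym (All.lookup Fu i))
  ... | yes (inj₂ (refl , i)) = trans (Simple.adj-sym SE (All.lookup Eu i)) (sym (Simple.adj-sym SF (All.lookup Fu i)))
  ... | no ¬q = trans (sym (delete-keep E ¬q)) (trans (eq x y) (delete-keep F ¬q))

-- Pieces hanging at a root

Disjoint : ∀ {n} → VSet n → VSet n → Set
Disjoint K L = ∀ x → K x ≡ true → L x ≡ true → ⊥

ConnectedFrom : ∀ {n} → Graph n → VSet n → Fin n → Set
ConnectedFrom E K c = ∀ {x} → K x ≡ true → ∃ λ xs → Path E c xs x × All (λ z → K z ≡ true) xs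

record Piece (n : ℕ) : Set where
  constructor piece
  field
    region : VSet n
    anchor : Fin n
    leaves : List (Fin n × VSet n)

  leafVertices : List (Fin n)
  leafVertices = map proj₁ leaves

open Piece

-- The branch `proj₂ l` is tied to the rest only at the anchor and by the single edge from its leaf
-- vertex to the root. Once that edge is cut, it hangs at the anchor alone and can be treated as a
-- piece there.
record IsLeaf {n} (E : Graph n) (p c : Fin n) (K : VSet n) (l : Fin n × VSet n) : Set where
  field
    self        : proj₂ l (proj₁ l) ≡ true
    away        : proj₂ l c ≡ false
    inside      : ∀ {x} → proj₂ l x ≡ true → K x ≡ true
    root-edge   : E p (proj₁ l) ≡ true
    anchor-edge : E c (proj₁ l) ≡ true
    closed      : ∀ {x y} → proj₂ l x ≡ true → E x y ≡ true →
                  proj₂ l y ≡ true ⊎ y ≡ c ⊎ (y ≡ p × x ≡ proj₁ l)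
    connected   : ConnectedFrom E (proj₂ l) (proj₁ l)

DisjointLeaves : ∀ {n} → Fin n × VSet n → Fin n × VSet n → Set
DisjointLeaves l m = Disjoint (proj₂ l) (proj₂ m)

-- The anchor need not be adjacent to the root. A detour over one vertex outside all branches is
-- allowed instead, which bounds the length of the chain and survives the cutting of the leaves.
Near : ∀ {n} → Graph n → Fin n → VSet n → Fin n → List (Fin n × VSet n) → Set
Near E p K c ls = E p c ≡ true ⊎ ∃ λ z → K z ≡ true × E p z ≡ true × E z c ≡ true × All (λ l → proj₂ l z ≡ false) ls

near-map : ∀ {n} {E : Graph n} {p K c ls ls′} → (∀ {P : Fin n × VSet n → Set} → All P ls → All P ls′) →
           Near E p K c ls → Near E p K c ls′
near-map f (inj₁ e)                    = inj₁ e
near-map f (inj₂ (z , Kz , e , d , a)) = inj₂ (z , Kz , e , d , f a)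

-- `closed` makes the root the only way out of the region. Together with `connected` it fixes the
-- region once the anchor is known, which is why a skeleton can omit the regions.
record IsPiece {n} (E : Graph n) (p : Fin n) (P : Piece n) : Set where
  field
    root∉     : region P p ≡ false
    anchor∈   : region P (anchor P) ≡ true
    closed    : ∀ {x y} → region P x ≡ true → E x y ≡ true → region P y ≡ true ⊎ y ≡ p
    connected : ConnectedFrom E (region P) (anchor P)
    near      : Near E p (region P) (anchor P) (leaves P)
    areLeaves : All (IsLeaf E p (anchor P) (region P)) (leaves P)
    disjoint  : AllPairs DisjointLeaves (leaves P)

DisjointPieces : ∀ {n} → Piece n → Piece n → Set
DisjointPieces P Q = Disjoint (region P) (region Q)

record IsPlan {n} (E : Graph n) (p : Fin n) (Ps : List (Piece n)) : Set where
  constructor plan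
  field
    arePieces : All (IsPiece E p) Ps
    disjoint  : AllPairs DisjointPieces Ps

union : ∀ {n} → List (Piece n) → VSet n
union []       x = false
union (P ∷ Ps) x = region P x ∨ union Ps x

union⁺ : ∀ {n} {P : Piece n} {Ps x} → P ∈ Ps → region P x ≡ true → union Ps x ≡ true
union⁺ (here refl) h rewrite h = refl
union⁺ {Ps = Q ∷ Ps} {x} (there i) h rewrite union⁺ i h = Boolₚ.∨-zeroʳ (region Q x)

union⁻ : ∀ {n} {Ps : List (Piece n)} {x} → union Ps x ≡ true → ∃ λ P → P ∈ Ps × region P x ≡ true
union⁻ {Ps = P ∷ Ps} {x} h with region P x in eq
... | true  = P , here refl , eq
... | false with union⁻ {Ps = Ps} h
...   | Q , i , q = Q , there i , q

union-false⁺ : ∀ {n} {Ps : List (Piece n)} {x} → (∀ {P} → P ∈ Ps → region P x ≢ true) → union Ps x ≡ false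
union-false⁺ {Ps = Ps} h = ≢true⇒false λ u → let (_ , i , q) = union⁻ {Ps = Ps} u in h i q

-- Once the anchor has become the root, each branch is itself a piece to be entered, at its leaf
-- vertex. This is how the leaves get onto the chain.
kids : ∀ {n} → Piece n → List (Piece n)
kids P = map (λ l → piece (proj₂ l) (proj₁ l) []) (leaves P)

-- Entering P: its leaves are cut off from the root, and all other pieces move to its anchor.
enter : ∀ {n} → Graph n → Fin n → Piece n → List (Piece n) → Graph n
enter E p P Ps = slide p (anchor P) (union Ps) (delete p (leafVertices P) E)

module Enter {n} {E : Graph n} (S : Simple E) {p : Fin n} {P : Piece n} {Ps : List (Piece n)}
             (isPlan : IsPlan E p (P ∷ Ps)) where

  open Simple S

  c  = anchor P
  K  = region P
  R  = union Ps
  us = leafVertices P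
  E₁ = delete p us E
  E₂ = enter E p P Ps

  isP : IsPiece E p P
  isP = All.head (IsPlan.arePieces isPlan)
  isPs : All (IsPiece E p) Ps
  isPs = All.tail (IsPlan.arePieces isPlan)
  K⊥Ps : All (DisjointPieces P) Ps
  K⊥Ps = AllPairs.head (IsPlan.disjoint isPlan)

  module isP = IsPiece isP

  Rp : R p ≡ false
  Rp = union-false⁺ λ i → false≢true (IsPiece.root∉ (All.lookup isPs i))

  K⇒¬R : ∀ {x} → K x ≡ true → R x ≡ false
  K⇒¬R Kx = union-false⁺ λ i → All.lookup K⊥Ps i _ Kx

  Rc : R c ≡ false
  Rc = K⇒¬R isP.anchor∈

  c≢p : c ≢ p
  c≢p eq = false≢true isP.root∉ (subst (λ z → K z ≡ true) eq isP.anchor∈)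

  closedR : ∀ {x y} → R x ≡ true → E x y ≡ true → R y ≡ true ⊎ y ≡ p
  closedR Rx e with union⁻ {Ps = Ps} Rx
  ... | Q , i , Qx with IsPiece.closed (All.lookup isPs i) Qx e
  ...   | inj₁ Qy = inj₁ (union⁺ i Qy)
  ...   | inj₂ q  = inj₂ q

  us⊆K : ∀ {u} → u ∈ us → K u ≡ true
  us⊆K i with ∈ₚ.∈-map⁻ proj₁ i
  ... | l , j , refl = let open IsLeaf (All.lookup isP.areLeaves j) in inside self

  simple₁ : Simple E₁
  simple₁ = delete-simple p us S

  simple₂ : Simple E₂
  simple₂ = slide-simple p c {R} simple₁

  closedR₁ : ∀ {x y} → R x ≡ true → E₁ x y ≡ true → R y ≡ true ⊎ y ≡ p
  closedR₁ Rx e = closedR Rx (delete-⊆ p us E _ _ e)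

  noLong₂ : NoLongCycle E → NoLongCycle E₂
  noLong₂ h = slide-noLongCycle p c Rp Rc simple₁ closedR₁ (subgraph-noLongCycle {E = E} {F = E₁} (delete-⊆ p us E) h)

  E₁-away : ∀ {x y} → x ≢ p → y ≢ p → E₁ x y ≡ E x y
  E₁-away x≢p y≢p = delete-keep p us E λ { (inj₁ (q , _)) → x≢p q ; (inj₂ (q , _)) → y≢p q }

  E₁-root : ∀ {y} → y ∉ us → E₁ p y ≡ E p y
  E₁-root y∉ = delete-keep p us E λ { (inj₁ (_ , i)) → y∉ i ; (inj₂ (refl , i)) → false≢true isP.root∉ (us⊆K i) }

  ∈⇒≢p : ∀ {L : VSet n} {x} → L p ≡ false → L x ≡ true → x ≢ p
  ∈⇒≢p Lp Lx refl = false≢true Lp Lx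

  E₂-in : ∀ {x y} → R x ≡ true → R y ≡ true → E₂ x y ≡ E x y
  E₂-in Rx Ry = trans (slide-same p c {R} E₁ (trans Rx (sym Ry))) (E₁-away (∈⇒≢p Rp Rx) (∈⇒≢p Rp Ry))

  E₂-out : ∀ {x y} → R x ≡ false → R y ≡ false → E₂ x y ≡ E₁ x y
  E₂-out Rx Ry = slide-same p c {R} E₁ (trans Rx (sym Ry))

  E₂-K : ∀ {x y} → K x ≡ true → K y ≡ true → E₂ x y ≡ E x y
  E₂-K Kx Ky = trans (E₂-out (K⇒¬R Kx) (K⇒¬R Ky)) (E₁-away (∈⇒≢p isP.root∉ Kx) (∈⇒≢p isP.root∉ Ky))

  E₂-leave : ∀ {x y} → R x ≡ true → R y ≡ false → E₂ x y ≡ true → y ≡ c × E x p ≡ true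
  E₂-leave Rx Ry e with slide-leave p c Rp Rc closedR₁ Rx Ry e
  ... | q , d = q , delete-⊆ p us E _ _ d

  -- The anchor inherits the part of the root towards the waiting pieces, so their `near` and
  -- `root-edge` hold again with `c` in place of `p`.
  E₂-anchor : ∀ {y} → R y ≡ true → E₂ c y ≡ E p y
  E₂-anchor {y} Ry = trans (slide-cross p c {R} E₁ λ q → false≢true Rc (trans q Ry))
    (trans (cong₂ E₁ (transpose-c p c) (transpose-in p c Rp Rc Ry))
           (E₁-root λ i → false≢true (K⇒¬R (us⊆K i)) Ry))

  kid-isPiece : ∀ {l} → l ∈ leaves P → IsPiece E₂ c (piece (proj₂ l) (proj₁ l) [])
  kid-isPiece {u , L} i = record
    { root∉     = away
    ; anchor∈   = self
    ; closed    = closed′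
    ; connected = λ Lx → let (xs , q , qs) = connected Lx in
                  xs , path-mono (λ Lx Ly e → trans (E₂-K (inside Lx) (inside Ly)) e) q qs , qs
    ; near      = inj₁ (trans (E₂-K isP.anchor∈ (inside self)) anchor-edge)
    ; areLeaves = []
    ; disjoint  = []
    }
    where
    open IsLeaf (All.lookup isP.areLeaves i)
    closed′ : ∀ {x y} → L x ≡ true → E₂ x y ≡ true → L y ≡ true ⊎ y ≡ c
    closed′ {x} {y} Lx e with true⊎false (R y)
    ... | inj₁ Ry = inj₂ (contradiction (proj₁ (E₂-leave Ry (K⇒¬R (inside Lx)) (Simple.adj-sym simple₂ e)))
                                        (λ { refl → false≢true away Lx }))
    ... | inj₂ Ry with trans (sym (E₂-out (K⇒¬R (inside Lx)) Ry)) e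
    ...   | e₁ with closed Lx (delete-⊆ p us E _ _ e₁)
    ...     | inj₁ Ly        = inj₁ Ly
    ...     | inj₂ (inj₁ q)  = inj₂ q
    -- The one edge of the branch to the old root is among the deleted edges.
    ...     | inj₂ (inj₂ (refl , refl)) =
      contradiction e₁ (false≢true (delete-cut p us E (inj₂ (refl , ∈ₚ.∈-map⁺ proj₁ i))))

  rest-isPiece : ∀ {Q} → Q ∈ Ps → IsPiece E₂ c Q
  rest-isPiece {Q} i = record
    { root∉     = ≢true⇒false (All.lookup K⊥Ps i _ isP.anchor∈)
    ; anchor∈   = anchor∈
    ; closed    = closed′
    ; connected = λ Qx → let (xs , q , qs) = connected Qx in xs , path-mono (λ x y → trans (E₂-in (Q⊆R x) (Q⊆R y))) q qs , qs
    ; near      = near′ near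
    ; areLeaves = All.map leaf′ areLeaves
    ; disjoint  = disjoint
    }
    where
    open IsPiece (All.lookup isPs i)
    Q⊆R : ∀ {x} → region Q x ≡ true → R x ≡ true
    Q⊆R = union⁺ i
    closed′ : ∀ {x y} → region Q x ≡ true → E₂ x y ≡ true → region Q y ≡ true ⊎ y ≡ c
    closed′ {x} {y} Qx e with true⊎false (R y)
    ... | inj₂ Ry = inj₂ (proj₁ (E₂-leave (Q⊆R Qx) Ry e))
    ... | inj₁ Ry with closed Qx (trans (sym (E₂-in (Q⊆R Qx) Ry)) e)
    ...   | inj₁ Qy = inj₁ Qy
    ...   | inj₂ refl = contradiction Ry (false≢true Rp)
    near′ : Near E p (region Q) (anchor Q) (leaves Q) → Near E₂ c (region Q) (anchor Q) (leaves Q)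
    near′ (inj₁ e) = inj₁ (trans (E₂-anchor (Q⊆R anchor∈)) e)
    near′ (inj₂ (z , Qz , e , d , a)) =
      inj₂ (z , Qz , trans (E₂-anchor (Q⊆R Qz)) e , trans (E₂-in (Q⊆R Qz) (Q⊆R anchor∈)) d , a)
    leaf′ : ∀ {l} → IsLeaf E p (anchor Q) (region Q) l → IsLeaf E₂ c (anchor Q) (region Q) l
    leaf′ {u , L} isL = record
      { self = self
      ; away = away
      ; inside = inside
      ; root-edge = trans (E₂-anchor (L⊆R self)) root-edge
      ; anchor-edge = trans (E₂-in (Q⊆R anchor∈) (L⊆R self)) anchor-edge
      ; closed = closed″
      ; connected = λ Lx → let (xs , q , qs) = connectedL Lx in xs , path-mono (λ x y → trans (E₂-in (L⊆R x) (L⊆R y))) q qs , qs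
      }
      where
      open IsLeaf isL using (self; away; inside; root-edge; anchor-edge) renaming (closed to closedL; connected to connectedL)
      L⊆R : ∀ {x} → L x ≡ true → R x ≡ true
      L⊆R Lx = Q⊆R (inside Lx)
      closed″ : ∀ {x y} → L x ≡ true → E₂ x y ≡ true → L y ≡ true ⊎ y ≡ anchor Q ⊎ (y ≡ c × x ≡ u)
      closed″ {x} {y} Lx e with true⊎false (R y)
      ... | inj₁ Ry with closedL Lx (trans (sym (E₂-in (L⊆R Lx) Ry)) e)
      ...   | inj₁ Ly = inj₁ Ly
      ...   | inj₂ (inj₁ q) = inj₂ (inj₁ q)
      ...   | inj₂ (inj₂ (refl , _)) = contradiction Ry (false≢true Rp)
      closed″ {x} {y} Lx e | inj₂ Ry with E₂-leave (L⊆R Lx) Ry e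
      ... | q , d with closedL Lx d
      ...   | inj₁ Lp = contradiction (L⊆R Lp) (false≢true Rp)
      ...   | inj₂ (inj₁ refl) = contradiction (Q⊆R anchor∈) (false≢true Rp)
      ...   | inj₂ (inj₂ (_ , r)) = inj₂ (inj₂ (q , r))

  enter-isPlan : IsPlan E₂ c (kids P ++ Ps)
  enter-isPlan = plan
    (Allₚ.++⁺ (Allₚ.map⁺ (All.tabulate kid-isPiece)) (All.tabulate rest-isPiece))
    (AllPairsₚ.++⁺ (AllPairsₚ.map⁺ isP.disjoint) (AllPairs.tail (IsPlan.disjoint isPlan))
      (Allₚ.map⁺ (All.map (λ isL → All.map (λ d _ Lx → d _ (IsLeaf.inside isL Lx)) K⊥Ps) isP.areLeaves)))

  R⁺ = union (kids P ++ Ps)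

  R⁺⇒ : ∀ {x} → R⁺ x ≡ true → (∃ λ l → l ∈ leaves P × proj₂ l x ≡ true) ⊎ R x ≡ true
  R⁺⇒ {x} h with union⁻ {Ps = kids P ++ Ps} h
  ... | Q , i , Qx with ∈ₚ.∈-++⁻ (kids P) i
  ...   | inj₂ j = inj₂ (union⁺ j Qx)
  ...   | inj₁ j with ∈ₚ.∈-map⁻ _ j
  ...     | l , k , refl = inj₁ (l , k , Qx)

  R⊆R⁺ : ∀ {x} → R x ≡ true → R⁺ x ≡ true
  R⊆R⁺ Rx with union⁻ {Ps = Ps} Rx
  ... | Q , i , Qx = union⁺ (∈ₚ.∈-++⁺ʳ (kids P) i) Qx

  R⁺⊆union : ∀ {x} → R⁺ x ≡ true → union (P ∷ Ps) x ≡ true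
  R⁺⊆union {x} h with R⁺⇒ h
  ... | inj₂ Rx rewrite Rx = Boolₚ.∨-zeroʳ (K x)
  ... | inj₁ (l , i , Lx) rewrite IsLeaf.inside (All.lookup isP.areLeaves i) Lx = refl

  R⁺-false : ∀ {x} → R x ≡ false → All (λ l → proj₂ l x ≡ false) (leaves P) → R⁺ x ≡ false
  R⁺-false Rx a = ≢true⇒false λ h → case R⁺⇒ h of λ
    { (inj₁ (l , i , Lx)) → false≢true (All.lookup a i) Lx
    ; (inj₂ Rx′) → false≢true Rx Rx′ }

  R⁺p : R⁺ p ≡ false
  R⁺p = R⁺-false Rp (All.map (λ isL → ≢true⇒false λ Lp → false≢true isP.root∉ (IsLeaf.inside isL Lp)) isP.areLeaves)

  R⁺c : R⁺ c ≡ false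
  R⁺c = R⁺-false Rc (All.map IsLeaf.away isP.areLeaves)

  -- The middle vertex lies in no branch. Hence it is not a leaf and keeps its edge to the root, and
  -- it is in no piece still to be entered, so later steps leave the connection intact.
  near₂ : E₂ p c ≡ true ⊎ ∃ λ z → R⁺ z ≡ false × E₂ p z ≡ true × E₂ z c ≡ true
  near₂ with isP.near
  ... | inj₁ e = inj₁ (trans (E₂-out Rp Rc) (trans (E₁-root c∉us) e))
    where
    c∉us : c ∉ us
    c∉us i with ∈ₚ.∈-map⁻ proj₁ i
    ... | (u , L) , j , refl = let open IsLeaf (All.lookup isP.areLeaves j) in false≢true away self
  ... | inj₂ (z , Kz , e , d , a) =
    inj₂ (z , R⁺-false (K⇒¬R Kz) a , trans (E₂-out Rp (K⇒¬R Kz)) (trans (E₁-root z∉us) e) , trans (E₂-K Kz isP.anchor∈) d)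
    where
    z∉us : z ∉ us
    z∉us i with ∈ₚ.∈-map⁻ proj₁ i
    ... | (u , L) , j , refl = let open IsLeaf (All.lookup isP.areLeaves j) in false≢true (All.lookup a j) self

-- Entering all pieces one after the other

Skeleton : ℕ → Set
Skeleton n = List (Fin n × List (Fin n))

module _ {n : ℕ} where

  outline : Piece n → Fin n × List (Fin n)
  outline P = anchor P , leafVertices P

  size : Skeleton n → ℕ
  size []             = 0
  size ((_ , us) ∷ s) = suc (length us + size s)

  flat : Skeleton n → List (Fin n)
  flat []             = []
  flat ((c , us) ∷ s) = c ∷ us ++ flat s

  solo : Fin n → Fin n × List (Fin n)
  solo u = u , []

  outline-enter : ∀ (P : Piece n) Ps → map outline (kids P ++ Ps) ≡ map solo (leafVertices P) ++ map outline Ps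
  outline-enter P Ps = trans (Listₚ.map-++ outline (kids P) Ps)
    (cong (_++ map outline Ps) (trans (sym (Listₚ.map-∘ (leaves P))) (Listₚ.map-∘ (leaves P))))

  size-solo : ∀ us s → size (map solo us ++ s) ≡ length us + size s
  size-solo []       s = refl
  size-solo (u ∷ us) s = cong suc (size-solo us s)

  flat-solo : ∀ us s → flat (map solo us ++ s) ≡ us ++ flat s
  flat-solo []       s = refl
  flat-solo (u ∷ us) s = cong (u ∷_) (flat-solo us s)

  -- The list of pieces can grow, since leaves turn into pieces. What drops by one with each entry
  -- is the number of anchors and leaves together, and this is the counter.
  run : ℕ → Graph n → Fin n → List (Piece n) → Graph n × Fin n
  run zero    E p Ps       = E , p
  run (suc k) E p []       = E , p
  run (suc k) E p (P ∷ Ps) = run k (enter E p P Ps) (anchor P) (kids P ++ Ps)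

  size-enter : ∀ {k} P Ps → size (map outline (P ∷ Ps)) ≡ suc k → size (map outline (kids P ++ Ps)) ≡ k
  size-enter P Ps eq = trans (cong size (outline-enter P Ps))
    (trans (size-solo (leafVertices P) (map outline Ps)) (suc-injective eq))

  -- An invariant strong enough for induction. `sealed` and `end` force every path to the end of the
  -- chain through the next anchor, which gives `visits`. `agree` protects the connections already
  -- built, which gives `short`.
  record RunSpec (E : Graph n) (p : Fin n) (Ps : List (Piece n)) (F : Graph n) (e : Fin n) : Set where
    field
      simple : Simple F
      noLong : NoLongCycle F
      agree  : ∀ {x y} → union Ps x ≡ false → union Ps y ≡ false → F x y ≡ E x y
      sealed : ∀ {x y} → union Ps x ≡ true → F x y ≡ true → union Ps y ≡ true ⊎ y ≡ p
      end    : union Ps e ≡ true ⊎ e ≡ p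
      short  : ∃ λ xs → Path F p xs e × length xs ≤ suc (2 * size (map outline Ps))
      visits : ∀ {xs} → Path F p xs e → (p ∷ flat (map outline Ps)) ⊆ xs

  run-spec : ∀ k {E p Ps} → size (map outline Ps) ≡ k → Simple E → NoLongCycle E → IsPlan E p Ps →
             RunSpec E p Ps (proj₁ (run k E p Ps)) (proj₂ (run k E p Ps))
  run-spec zero {E} {p} {[]} refl S L _ = record
    { simple = S
    ; noLong = L
    ; agree  = λ _ _ → refl
    ; sealed = λ ()
    ; end    = inj₂ refl
    ; short  = _ , stop , ≤-refl
    ; visits = λ { stop → refl ∷ [] ; (_ ∷ _) → refl ∷ minimum _ }
    }
  run-spec (suc k) {E} {p} {P ∷ Ps} eq S L isPlan = record
    { simple = IH.simple
    ; noLong = IH.noLong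
    ; agree  = agree′
    ; sealed = sealed′
    ; end    = end′
    ; short  = short′ near₂
    ; visits = visits′
    }
    where
    open Enter S isPlan
    module IH = RunSpec (run-spec k (size-enter P Ps eq) simple₂ (noLong₂ L) enter-isPlan)
    F = proj₁ (run k E₂ c (kids P ++ Ps))
    e = proj₂ (run k E₂ c (kids P ++ Ps))
    U = union (P ∷ Ps)

    K⊆U : ∀ {x} → K x ≡ true → U x ≡ true
    K⊆U Kx rewrite Kx = refl

    ¬U⇒¬R⁺ : ∀ {x} → U x ≡ false → R⁺ x ≡ false
    ¬U⇒¬R⁺ Ux = ≢true⇒false λ h → false≢true Ux (R⁺⊆union h)

    ¬R⁺⇒¬R : ∀ {x} → R⁺ x ≡ false → R x ≡ false
    ¬R⁺⇒¬R h = ≢true⇒false λ Rx → false≢true h (R⊆R⁺ Rx)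

    agree′ : ∀ {x y} → U x ≡ false → U y ≡ false → F x y ≡ E x y
    agree′ Ux Uy = trans (IH.agree (¬U⇒¬R⁺ Ux) (¬U⇒¬R⁺ Uy))
      (trans (E₂-out (¬R⁺⇒¬R (¬U⇒¬R⁺ Ux)) (¬R⁺⇒¬R (¬U⇒¬R⁺ Uy)))
        (delete-keep p us E λ { (inj₁ (_ , i)) → false≢true Uy (K⊆U (us⊆K i)) ; (inj₂ (_ , i)) → false≢true Ux (K⊆U (us⊆K i)) }))

    sealed′ : ∀ {x y} → U x ≡ true → F x y ≡ true → U y ≡ true ⊎ y ≡ p
    sealed′ {x} {y} Ux f with true⊎false (R⁺ y)
    ... | inj₁ Ry = inj₁ (R⁺⊆union Ry)
    ... | inj₂ Ry with true⊎false (R⁺ x)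
    ...   | inj₁ Rx with IH.sealed Rx f
    ...     | inj₁ Ry′  = inj₁ (R⁺⊆union Ry′)
    ...     | inj₂ refl = inj₁ (K⊆U isP.anchor∈)
    sealed′ {x} {y} Ux f | inj₂ Ry | inj₂ Rx with true⊎false (K x)
    ... | inj₂ Kx = contradiction Ux (false≢true (trans (cong₂ _∨_ Kx (¬R⁺⇒¬R Rx)) refl))
    ... | inj₁ Kx with isP.closed Kx (delete-⊆ p us E x y (trans (sym (trans (IH.agree Rx Ry) (E₂-out (¬R⁺⇒¬R Rx) (¬R⁺⇒¬R Ry)))) f))
    ...   | inj₁ Ky = inj₁ (K⊆U Ky)
    ...   | inj₂ q  = inj₂ q

    end′ : U e ≡ true ⊎ e ≡ p
    end′ with IH.end
    ... | inj₁ Re = inj₁ (R⁺⊆union Re)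
    ... | inj₂ q  = inj₁ (K⊆U (subst (λ z → K z ≡ true) (sym q) isP.anchor∈))

    short′ : (E₂ p c ≡ true ⊎ ∃ λ z → R⁺ z ≡ false × E₂ p z ≡ true × E₂ z c ≡ true) →
             ∃ λ xs → Path F p xs e × length xs ≤ suc (2 * size (map outline (P ∷ Ps)))
    short′ h with IH.short
    ... | xs , q , l = prepend h
      where
      bound : suc (suc (length xs)) ≤ suc (2 * size (map outline (P ∷ Ps)))
      bound = subst (λ s → suc (suc (length xs)) ≤ suc (2 * s)) (trans (cong suc (size-enter P Ps eq)) (sym eq))
        (s≤s (≤-trans (s≤s l) (≤-reflexive (sym (*-suc 2 _)))))
      prepend : (E₂ p c ≡ true ⊎ ∃ λ z → R⁺ z ≡ false × E₂ p z ≡ true × E₂ z c ≡ true) →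
                ∃ λ xs → Path F p xs e × length xs ≤ suc (2 * size (map outline (P ∷ Ps)))
      prepend (inj₁ d) = p ∷ xs , trans (IH.agree R⁺p R⁺c) d ∷ q , ≤-trans (n≤1+n _) bound
      prepend (inj₂ (z , Rz , d , d′)) = p ∷ z ∷ xs , trans (IH.agree R⁺p Rz) d ∷ trans (IH.agree Rz R⁺c) d′ ∷ q , bound

    -- The end `e` is in `R⁺` or equals `c`, and by `IH.sealed` the set `R⁺` can be entered from `c`
    -- only.
    passes : ∀ {x xs} → Path F x xs e → R⁺ x ≡ false → x ≢ c → c ∈ xs
    passes stop Rx x≢c with IH.end
    ... | inj₁ Re = contradiction Re (false≢true Rx)
    ... | inj₂ q  = contradiction q x≢c
    passes {x} (_∷_ {y = y} f q) Rx x≢c with y ≟ c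
    ... | yes refl = there (source∈ q)
    ... | no y≢c with true⊎false (R⁺ y)
    ...   | inj₂ Ry = there (passes q Ry y≢c)
    ...   | inj₁ Ry with IH.sealed Ry (Simple.adj-sym IH.simple f)
    ...     | inj₁ Rx′ = contradiction Rx′ (false≢true Rx)
    ...     | inj₂ r   = contradiction r x≢c

    flat-enter : flat (map outline (kids P ++ Ps)) ≡ us ++ flat (map outline Ps)
    flat-enter = trans (cong flat (outline-enter P Ps)) (flat-solo us (map outline Ps))

    visits′ : ∀ {xs} → Path F p xs e → (p ∷ c ∷ us ++ flat (map outline Ps)) ⊆ xs
    visits′ q with path-split q (passes q R⁺p (≢-sym c≢p))
    ... | inj₁ r = contradiction r c≢p
    ... | inj₂ (_ , bs , _ , stop , _ , r , refl) = refl ∷ subst (λ l → (c ∷ l) ⊆ bs) flat-enter (IH.visits r)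
    ... | inj₂ (_ , bs , _ , _∷_ {xs = as} _ _ , _ , r , refl) =
      refl ∷ Sublistₚ.++⁺ˡ as (subst (λ l → (c ∷ l) ⊆ bs) flat-enter (IH.visits r))

  slide-cong : ∀ p c {R R′ : VSet n} {E E′ : Graph n} → (∀ x → R x ≡ R′ x) → (∀ x y → E x y ≡ E′ x y) →
               ∀ x y → slide p c R E x y ≡ slide p c R′ E′ x y
  slide-cong p c {R} {R′} R≗ E≗ x y with R x Boolₚ.≟ R y | R′ x Boolₚ.≟ R′ y
  ... | yes _ | yes _ = E≗ x y
  ... | no _  | no _  = E≗ _ _
  ... | yes q | no ¬q = contradiction (trans (sym (R≗ x)) (trans q (R≗ y))) ¬q
  ... | no ¬q | yes q = contradiction (trans (R≗ x) (trans q (sym (R≗ y)))) ¬q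

  -- The union of the pieces is recovered as the set of vertices reachable from their anchors without passing the root.
  union-determined : ∀ {E F : Graph n} {c Ps Qs} → (∀ x y → E x y ≡ F x y) → IsPlan E c Ps → IsPlan F c Qs →
                     map outline Ps ≡ map outline Qs → ∀ x → union Ps x ≡ true → union Qs x ≡ true
  union-determined {E} {F} {c} {Ps} {Qs} E≗F isPs isQs eq x h with union⁻ {Ps = Ps} h
  ... | P , i , Px with ∈ₚ.∈-map⁻ outline (subst (outline P ∈_) eq (∈ₚ.∈-map⁺ outline i))
  ...   | Q , j , o with IsPiece.connected (All.lookup (IsPlan.arePieces isPs) i) Px
  ...     | xs , q , qs = union⁺ j (follow q qs (subst (λ z → region Q z ≡ true) (sym (cong proj₁ o)) isQ.anchor∈))
    where
    module isP = IsPiece (All.lookup (IsPlan.arePieces isPs) i)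
    module isQ = IsPiece (All.lookup (IsPlan.arePieces isQs) j)
    follow : ∀ {a as b} → Path E a as b → All (λ z → region P z ≡ true) as → region Q a ≡ true → region Q b ≡ true
    follow stop _ Qa = Qa
    follow (e ∷ q) (_ ∷ qs) Qa with isQ.closed Qa (trans (sym (E≗F _ _)) e)
    ... | inj₁ Qy   = follow q qs Qy
    ... | inj₂ refl = contradiction (All.lookup qs (source∈ q)) (false≢true isP.root∉)

  plan-tail : ∀ {E : Graph n} {c Ps} Qs → IsPlan E c (Qs ++ Ps) → IsPlan E c Ps
  plan-tail []       h                        = h
  plan-tail (_ ∷ Qs) (plan (_ ∷ as) (_ ∷ ds)) = plan-tail Qs (plan as ds)

  -- The steps are undone from the last to the first. The outlines do not contain the set that was
  -- moved, so it is read off the graph after the step by `union-determined`. Sliding back is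
  -- sliding again, and the cut edges are known from the root and the leaf list.
  run-injective : ∀ k {E F : Graph n} {p Ps Qs} → size (map outline Ps) ≡ k → map outline Ps ≡ map outline Qs →
                  Simple E → Simple F → IsPlan E p Ps → IsPlan F p Qs →
                  (∀ x y → proj₁ (run k E p Ps) x y ≡ proj₁ (run k F p Qs) x y) → ∀ x y → E x y ≡ F x y
  run-injective zero _ _ _ _ _ _ h = h
  run-injective (suc k) {Ps = []} ()
  run-injective (suc k) {Ps = _ ∷ _} {Qs = []} _ ()
  run-injective (suc k) {E} {F} {p} {P ∷ Ps} {Q ∷ Qs} sz eq SE SF isPs isQs h = undo (cong proj₁ same) (cong proj₂ same)
    where
    same = Listₚ.∷-injectiveˡ eq
    same-rest = Listₚ.∷-injectiveʳ eq
    module A = Enter SE isPs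
    module B = Enter SF isQs
    undo : A.c ≡ B.c → A.us ≡ B.us → ∀ x y → E x y ≡ F x y
    undo refl us≡ = delete-injective p A.us SE SF (root-edges A.isP.areLeaves)
      (subst (All (λ u → F p u ≡ true)) (sym us≡) (root-edges B.isP.areLeaves)) E₁≗F₁
      where
      root-edges : ∀ {G : Graph n} {c K ls} → All (IsLeaf G p c K) ls → All (λ u → G p u ≡ true) (map proj₁ ls)
      root-edges ls = Allₚ.map⁺ (All.map IsLeaf.root-edge ls)
      E₂≗F₂ : ∀ x y → A.E₂ x y ≡ B.E₂ x y
      E₂≗F₂ = run-injective k (size-enter P Ps sz)
        (trans (outline-enter P Ps) (trans (cong₂ _++_ (cong (map solo) us≡) same-rest) (sym (outline-enter Q Qs))))
        A.simple₂ B.simple₂ A.enter-isPlan B.enter-isPlan h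
      restA = plan-tail (kids P) A.enter-isPlan
      restB = plan-tail (kids Q) B.enter-isPlan
      R≗ : ∀ x → A.R x ≡ B.R x
      R≗ x = bool-cong (union-determined E₂≗F₂ restA restB same-rest x)
                       (union-determined (λ a b → sym (E₂≗F₂ a b)) restB restA (sym same-rest) x)
      E₁≗F₁ : ∀ x y → delete p A.us E x y ≡ delete p A.us F x y
      E₁≗F₁ x y = trans (sym (slide-involutive p A.c A.Rp A.Rc A.E₁ x y))
        (trans (slide-cong p A.c R≗ E₂≗F₂ x y)
          (trans (slide-involutive p A.c B.Rp B.Rc B.E₁ x y) (cong (λ us → delete p us F x y) (sym us≡))))

-- Decomposing the neighbourhood of a vertex into pieces

does⇒ : ∀ {A : Set} (d : Dec A) → does d ≡ true → A
does⇒ (yes a) _ = a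

⇒does : ∀ {A : Set} (d : Dec A) → A → does d ≡ true
⇒does (yes _) _ = refl
⇒does (no ¬a) a = contradiction a ¬a

length-filter-split : ∀ {A : Set} {P : A → Set} (P? : ∀ x → Dec (P x)) xs →
                      length xs ≡ length (filter P? xs) + length (filter (¬? ∘ P?) xs)
length-filter-split P? []       = refl
length-filter-split P? (x ∷ xs) with P? x
... | yes _ = cong suc (length-filter-split P? xs)
... | no _  = trans (cong suc (length-filter-split P? xs)) (sym (+-suc _ _))

remove-∈ : ∀ {A : Set} {x : A} (as bs : List A) {z} → z ∈ as ++ x ∷ bs → z ≢ x → z ∈ as ++ bs
remove-∈ as bs i z≢x with ∈ₚ.∈-++⁻ as i
... | inj₁ j           = ∈ₚ.∈-++⁺ˡ j
... | inj₂ (here q)    = contradiction q z≢x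
... | inj₂ (there j)   = ∈ₚ.∈-++⁺ʳ as j

-- Pigeonhole for a relation instead of a function, because in the double count the image of an
-- element is found only from a proof of its membership.
injective-length≤ : ∀ {A B : Set} {R : A → B → Set} → (∀ {x x′ y} → R x y → R x′ y → x ≡ x′) →
                    ∀ {xs ys} → Unique xs → (∀ {x} → x ∈ xs → ∃ λ y → y ∈ ys × R x y) → length xs ≤ length ys
injective-length≤ inj {[]} _ _ = z≤n
injective-length≤ {R = R} inj {x ∷ xs} (x≢ ∷ u) h with h (here refl)
... | y , i , r with ∈ₚ.∈-∃++ i
...   | as , bs , refl = ≤-trans (s≤s (injective-length≤ inj u sub))
  (≤-reflexive (trans (cong suc (Listₚ.length-++ as)) (trans (sym (+-suc (length as) (length bs))) (sym (Listₚ.length-++ as)))))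
  where
  sub : ∀ {z} → z ∈ xs → ∃ λ w → w ∈ as ++ bs × R z w
  sub j with h (there j)
  ... | w , k , s = w , remove-∈ as bs k (λ { refl → All.lookup x≢ j (inj r s) }) , s

unique-⊆⇒length≤ : ∀ {A : Set} {xs ys : List A} → Unique xs → (∀ {z} → z ∈ xs → z ∈ ys) → length xs ≤ length ys
unique-⊆⇒length≤ u sub = injective-length≤ (λ p q → trans p (sym q)) u λ i → _ , sub i , refl

module _ {n : ℕ} where

  fresh : ∀ {xs ys : List (Fin n)} → Unique xs → length ys < length xs → ∃ λ x → x ∈ xs × x ∉ ys
  fresh {xs} {ys} u l with Any.any? (λ x → ¬? (Any.any? (x ≟_) ys)) xs
  ... | yes h = find h
  ... | no ¬h = contradiction (unique-⊆⇒length≤ u λ {z} i → decidable-stable (Any.any? (z ≟_) ys) λ z∉ → ¬h (Any.map (λ { refl → z∉ }) i))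
                              (<⇒≱ l)

  length-remove : ∀ (a : Fin n) {xs} → Unique xs → length xs ≤ suc (length (filter (λ x → ¬? (x ≟ a)) xs))
  length-remove a {xs} u = unique-⊆⇒length≤ u λ {z} i → case z ≟ a of λ
    { (yes refl) → here refl ; (no z≢a) → there (∈ₚ.∈-filter⁺ (λ x → ¬? (x ≟ a)) i z≢a) }

  Joined : Graph n → (Fin n → Set) → Fin n → Fin n → Set
  Joined E P x y = ∃ λ xs → Path E x xs y × All P xs

  module _ {E : Graph n} where

    joined-trans : ∀ {P x y z} → Joined E P x y → Joined E P y z → Joined E P x z
    joined-trans (_ , stop , _) h = h
    joined-trans (_ , e ∷ q , px ∷ ps) h = let (_ , r , rs) = joined-trans (_ , q , ps) h in _ , e ∷ r , px ∷ rs

    joined-sym : Simple E → ∀ {P x y} → Joined E P x y → Joined E P y x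
    joined-sym S (_ , q , ps) = _ , path-reverse S q , all-reverse ps

    joined-refl : ∀ {P : Fin n → Set} {x} → P x → Joined E P x x
    joined-refl px = _ , stop , px ∷ []

    joined-edge : ∀ {P : Fin n → Set} {x y} → E x y ≡ true → P x → P y → Joined E P x y
    joined-edge e px py = _ , e ∷ stop , px ∷ py ∷ []

    joined-target : ∀ {P x y} → Joined E P x y → P y
    joined-target (_ , q , ps) = All.lookup ps (target∈ q)

    reached : ∀ {P : Fin n → Set} → (∀ x y → Dec (Joined E P x y)) → Fin n → VSet n
    reached j? c x = does (j? c x)

    reached-connected : ∀ {P : Fin n → Set} (j? : ∀ x y → Dec (Joined E P x y)) c → ConnectedFrom E (reached j? c) c
    reached-connected j? c {x} h with does⇒ (j? c x) h
    ... | xs , q , ps = xs , q , All.tabulate λ {z} i → ⇒does (j? c z) (upTo z i)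
      where
      upTo : ∀ z → z ∈ xs → Joined E _ c z
      upTo z i with path-prefix q i
      ... | as , bs , refl , r = as , r , Allₚ.++⁻ˡ as ps

  path-first : ∀ {E : Graph n} {B : Fin n → Set} (B? : ∀ x → Dec (B x)) {x xs y} → Path E x xs y → B y →
               ∃₂ λ as bs → ∃ λ w → xs ≡ as ++ bs × Path E x as w × B w × All (λ z → ¬ B z ⊎ z ≡ w) as
  path-first B? stop By = _ , [] , _ , refl , stop , By , inj₂ refl ∷ []
  path-first B? (_∷_ {x} e q) By with B? x
  ... | yes Bx = x ∷ [] , _ , x , refl , stop , Bx , inj₂ refl ∷ []
  ... | no ¬Bx with path-first B? q By
  ...   | as , bs , w , refl , r , Bw , h = x ∷ as , bs , w , refl , e ∷ r , Bw , inj₁ ¬Bx ∷ h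

-- Stars around a vertex in a graph without long cycles

module Structure {n} {E : Graph n} (S : Simple E) (noLong : NoLongCycle E) (v : Fin n)
                 (joined₁? : ∀ x y → Dec (Joined E (_≢ v) x y))
                 (joined₂? : ∀ c x y → Dec (Joined E (λ z → z ≢ v × z ≢ c) x y)) where

  open Simple S

  Neighbour : Fin n → Set
  Neighbour w = E v w ≡ true

  hexagon : ∀ {a b c d e f} → E a b ≡ true → E b c ≡ true → E c d ≡ true → E d e ≡ true → E e f ≡ true → E f a ≡ true →
            Unique (a ∷ b ∷ c ∷ d ∷ e ∷ f ∷ []) → ⊥
  hexagon ab bc cd de ef fa u = noLong (ab ∷ bc ∷ cd ∷ de ∷ ef ∷ stop) u fa ≤-refl

  octagon : ∀ {a b c d e f g h} → E a b ≡ true → E b c ≡ true → E c d ≡ true → E d e ≡ true → E e f ≡ true →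
            E f g ≡ true → E g h ≡ true → E h a ≡ true → Unique (a ∷ b ∷ c ∷ d ∷ e ∷ f ∷ g ∷ h ∷ []) → ⊥
  octagon ab bc cd de ef fg gh ha u =
    noLong (ab ∷ bc ∷ cd ∷ de ∷ ef ∷ fg ∷ gh ∷ stop) u ha (≤-trans (n≤1+n 6) (n≤1+n 7))

  record Hub (c : Fin n) (us : List (Fin n)) : Set where
    field
      c≢v     : c ≢ v
      unique  : Unique us
      spokes  : All (λ u → Neighbour u × E c u ≡ true) us

  module FindHub (a : Fin n) (va : Neighbour a) where

    a≢v : a ≢ v
    a≢v = ≢-sym (adj⇒≢ va)

    Near₂ : Fin n → Set
    Near₂ w = ∃ λ x → x ≢ v × E a x ≡ true × E x w ≡ true

    Near₃ : Fin n → Set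
    Near₃ w = ∃₂ λ x y → x ≢ v × y ≢ v × E a x ≡ true × E x y ≡ true × E y w ≡ true

    near₁? : ∀ w → Dec (E a w ≡ true)
    near₁? w = E a w Boolₚ.≟ true

    near₂? : ∀ w → Dec (Near₂ w)
    near₂? w = Finₚ.any? λ x → ¬? (x ≟ v) ×-dec (E a x Boolₚ.≟ true) ×-dec (E x w Boolₚ.≟ true)

    Mate : Fin n → Set
    Mate w = Neighbour w × w ≢ a × Joined E (_≢ v) a w

    classify : ∀ {w} → Mate w → E a w ≡ true ⊎ Near₂ w ⊎ Near₃ w
    classify (vw , w≢a , _ , q , ps) with simplePath q ps
    ... | _ , stop , _ = contradiction refl w≢a
    ... | _ , e ∷ stop , _ = inj₁ e
    ... | _ , e ∷ d ∷ stop , _ , (_ ∷ x≢v ∷ _) = inj₂ (inj₁ (_ , x≢v , e , d))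
    ... | _ , e ∷ d ∷ f ∷ stop , _ , (_ ∷ x≢v ∷ y≢v ∷ _) = inj₂ (inj₂ (_ , _ , x≢v , y≢v , e , d , f))
    -- At least four edges mean at least five vertices, and `v` closes them to a long cycle.
    ... | _ , r@(_ ∷ _ ∷ _ ∷ _ ∷ r′) , u , qs =
      ⊥-elim (noLong (va ∷ r) (All.map ≢-sym qs ∷ u) (adj-sym vw) (s≤s (s≤s (s≤s (s≤s (s≤s (∈ₚ.∈-length (source∈ r′))))))))

    -- Different middle vertices `x` and `x′` would give the hexagon v w x a x′ w′. Excluding the
    -- neighbours of `a` keeps `w` apart from `x′` and `w′` apart from `x`.
    common₂ : ∀ ws → Unique ws → All (λ w → Mate w × E a w ≢ true × Near₂ w) ws →
              ∃ λ x → Joined E (_≢ v) a x × All (λ w → E x w ≡ true) ws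
    common₂ [] _ _ = a , joined-refl a≢v , []
    common₂ (w ∷ ws) (w≢ ∷ _) (((vw , w≢a , _) , ¬aw , x , x≢v , ax , xw) ∷ hs) =
      x , joined-edge ax a≢v x≢v , xw ∷ All.zipWith same (w≢ , hs)
      where
      same : ∀ {w′} → w ≢ w′ × (Mate w′ × E a w′ ≢ true × Near₂ w′) → E x w′ ≡ true
      same {w′} (w≢w′ , (vw′ , w′≢a , _) , ¬aw′ , x′ , x′≢v , ax′ , x′w′) with x ≟ x′
      ... | yes refl = x′w′
      ... | no x≢x′ = ⊥-elim (hexagon vw (adj-sym xw) (adj-sym ax) ax′ x′w′ (adj-sym vw′)
        ( (adj⇒≢ vw ∷ ≢-sym x≢v ∷ adj⇒≢ va ∷ ≢-sym x′≢v ∷ adj⇒≢ vw′ ∷ [])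
        ∷ (≢-sym (adj⇒≢ xw) ∷ w≢a ∷ (λ { refl → ¬aw ax′ }) ∷ w≢w′ ∷ [])
        ∷ (≢-sym (adj⇒≢ ax) ∷ x≢x′ ∷ (λ { refl → ¬aw′ ax }) ∷ [])
        ∷ (adj⇒≢ ax′ ∷ ≢-sym w′≢a ∷ [])
        ∷ (adj⇒≢ x′w′ ∷ [])
        ∷ [] ∷ []))

    -- Different last vertices `y` and `y′` would give the hexagon v w y x y′ w′ if the paths share
    -- `x`, and the octagon v w y x a x′ y′ w′ if not. Distinctness comes from excluding the two
    -- nearer classes, for instance `y` is not `w′` since `w′` is not `Near₂`.
    common₃ : ∀ ws → Unique ws → All (λ w → Mate w × E a w ≢ true × ¬ Near₂ w × Near₃ w) ws →
              ∃ λ y → Joined E (_≢ v) a y × All (λ w → E y w ≡ true) ws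
    common₃ [] _ _ = a , joined-refl a≢v , []
    common₃ (w ∷ ws) (w≢ ∷ _) (((vw , w≢a , _) , ¬aw , ¬2w , x , y , x≢v , y≢v , ax , xy , yw) ∷ hs) =
      y , joined-trans (joined-edge ax a≢v x≢v) (joined-edge xy x≢v y≢v) , yw ∷ All.zipWith same (w≢ , hs)
      where
      same : ∀ {w′} → w ≢ w′ × (Mate w′ × E a w′ ≢ true × ¬ Near₂ w′ × Near₃ w′) → E y w′ ≡ true
      same {w′} (w≢w′ , (vw′ , w′≢a , _) , ¬aw′ , ¬2w′ , x′ , y′ , x′≢v , y′≢v , ax′ , x′y′ , y′w′) with y ≟ y′
      ... | yes refl = y′w′
      ... | no y≢y′ with x ≟ x′
      ...   | yes refl = ⊥-elim (hexagon vw (adj-sym yw) (adj-sym xy) x′y′ y′w′ (adj-sym vw′)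
        ( (adj⇒≢ vw ∷ ≢-sym y≢v ∷ ≢-sym x≢v ∷ ≢-sym y′≢v ∷ adj⇒≢ vw′ ∷ [])
        ∷ (≢-sym (adj⇒≢ yw) ∷ (λ { refl → ¬aw ax }) ∷ (λ { refl → ¬2w (x , x≢v , ax , x′y′) }) ∷ w≢w′ ∷ [])
        ∷ (≢-sym (adj⇒≢ xy) ∷ y≢y′ ∷ (λ { refl → ¬2w′ (x , x≢v , ax , xy) }) ∷ [])
        ∷ (adj⇒≢ x′y′ ∷ (λ { refl → ¬aw′ ax }) ∷ [])
        ∷ (adj⇒≢ y′w′ ∷ [])
        ∷ [] ∷ []))
      ...   | no x≢x′ = ⊥-elim (octagon vw (adj-sym yw) (adj-sym xy) (adj-sym ax) ax′ x′y′ y′w′ (adj-sym vw′)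
        ( (adj⇒≢ vw ∷ ≢-sym y≢v ∷ ≢-sym x≢v ∷ adj⇒≢ va ∷ ≢-sym x′≢v ∷ ≢-sym y′≢v ∷ adj⇒≢ vw′ ∷ [])
        ∷ (≢-sym (adj⇒≢ yw) ∷ (λ { refl → ¬aw ax }) ∷ w≢a ∷ (λ { refl → ¬aw ax′ }) ∷ (λ { refl → ¬2w (x′ , x′≢v , ax′ , x′y′) }) ∷ w≢w′ ∷ [])
        ∷ (≢-sym (adj⇒≢ xy) ∷ (λ { refl → ¬aw yw }) ∷ (λ { refl → ¬2w (y , y≢v , ax′ , yw) }) ∷ y≢y′ ∷ (λ { refl → ¬2w′ (x , x≢v , ax , xy) }) ∷ [])
        ∷ (≢-sym (adj⇒≢ ax) ∷ x≢x′ ∷ (λ { refl → ¬2w′ (x , x≢v , ax , y′w′) }) ∷ (λ { refl → ¬aw′ ax }) ∷ [])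
        ∷ (adj⇒≢ ax′ ∷ (λ { refl → ¬aw′ y′w′ }) ∷ ≢-sym w′≢a ∷ [])
        ∷ (adj⇒≢ x′y′ ∷ (λ { refl → ¬aw′ ax′ }) ∷ [])
        ∷ (adj⇒≢ y′w′ ∷ [])
        ∷ [] ∷ []))

    -- Each of the three classes of mates has a common neighbour, which is `a` itself for the first,
    -- and the largest class contains a third of the mates.
    findHub : ∀ ws → Unique ws → All Mate ws →
              ∃₂ λ c us → Joined E (_≢ v) a c × Hub c us × length ws ≤ 3 * length us
    findHub ws u ms = choose (≤-total (length ws₁) (length ws₂)) (≤-total (length ws₁) (length ws₃)) (≤-total (length ws₂) (length ws₃))
      where
      ws₁ = filter near₁? ws
      far = filter (¬? ∘ near₁?) ws
      ws₂ = filter near₂? far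
      ws₃ = filter (¬? ∘ near₂?) far
      mates-far : All (λ w → Mate w × E a w ≢ true) far
      mates-far = All.zip (Allₚ.filter⁺ (¬? ∘ near₁?) ms , Allₚ.all-filter (¬? ∘ near₁?) ws)
      u-far : Unique far
      u-far = Uniqueₚ.filter⁺ (¬? ∘ near₁?) u
      total : length ws ≡ length ws₁ + (length ws₂ + length ws₃)
      total = trans (length-filter-split near₁? ws) (cong (length ws₁ +_) (length-filter-split near₂? far))
      neighbours : ∀ {P : Fin n → Set} (P? : ∀ w → Dec (P w)) → All Neighbour (filter P? far)
      neighbours P? = All.map (proj₁ ∘ proj₁) (Allₚ.filter⁺ P? mates-far)
      Found = ∃₂ λ c us → Joined E (_≢ v) a c × Hub c us × length ws ≤ 3 * length us
      bound : ∀ {i j k m} → length ws ≡ i + (j + k) → i ≤ m → j ≤ m → k ≤ m → length ws ≤ 3 * m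
      bound {m = m} eq p q r = ≤-trans (≤-reflexive eq) (≤-trans (+-mono-≤ p (+-mono-≤ q r))
        (≤-reflexive (cong (λ z → m + (m + z)) (sym (+-identityʳ m)))))
      found₁ : length ws₂ ≤ length ws₁ → length ws₃ ≤ length ws₁ → Found
      found₁ p q = a , ws₁ , joined-refl a≢v , record
        { c≢v = a≢v ; unique = Uniqueₚ.filter⁺ near₁? u
        ; spokes = All.zip (All.map proj₁ (Allₚ.filter⁺ near₁? ms) , Allₚ.all-filter near₁? ws) } , bound total ≤-refl p q
      found₂ : length ws₁ ≤ length ws₂ → length ws₃ ≤ length ws₂ → Found
      found₂ p q with common₂ ws₂ (Uniqueₚ.filter⁺ near₂? u-far)
                      (All.zipWith (λ ((m , ¬1) , h) → m , ¬1 , h) (Allₚ.filter⁺ near₂? mates-far , Allₚ.all-filter near₂? far))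
      ... | x , j , xs = x , ws₂ , j , record
        { c≢v = joined-target j ; unique = Uniqueₚ.filter⁺ near₂? u-far ; spokes = All.zip (neighbours near₂? , xs) } , bound total p ≤-refl q
      found₃ : length ws₁ ≤ length ws₃ → length ws₂ ≤ length ws₃ → Found
      found₃ p q with common₃ ws₃ (Uniqueₚ.filter⁺ (¬? ∘ near₂?) u-far)
                      (All.zipWith third (Allₚ.filter⁺ (¬? ∘ near₂?) mates-far , Allₚ.all-filter (¬? ∘ near₂?) far))
        where
        third : ∀ {w} → (Mate w × E a w ≢ true) × ¬ Near₂ w → Mate w × E a w ≢ true × ¬ Near₂ w × Near₃ w
        third ((m , ¬1) , ¬2) with classify m
        ... | inj₁ h        = contradiction h ¬1
        ... | inj₂ (inj₁ h) = contradiction h ¬2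
        ... | inj₂ (inj₂ h) = m , ¬1 , ¬2 , h
      ... | y , j , ys = y , ws₃ , j , record
        { c≢v = joined-target j ; unique = Uniqueₚ.filter⁺ (¬? ∘ near₂?) u-far ; spokes = All.zip (neighbours (¬? ∘ near₂?) , ys) } , bound total p q ≤-refl
      choose : (length ws₁ ≤ length ws₂ ⊎ length ws₂ ≤ length ws₁) → (length ws₁ ≤ length ws₃ ⊎ length ws₃ ≤ length ws₁) →
               (length ws₂ ≤ length ws₃ ⊎ length ws₃ ≤ length ws₂) → Found
      choose (inj₂ p) (inj₂ q) _        = found₁ p q
      choose (inj₁ p) _        (inj₂ q) = found₂ p q
      choose _        (inj₁ p) (inj₁ q) = found₃ p q
      choose (inj₁ p) (inj₂ q) (inj₁ r) = found₃ (≤-trans p r) r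
      choose (inj₂ p) (inj₁ q) (inj₂ r) = found₁ p (≤-trans r p)

  module Prune {c : Fin n} {us₀ : List (Fin n)} (hub : Hub c us₀) (many : 5 ≤ length us₀) where

    open Hub hub

    Bad : Fin n → Set
    Bad u = ∃ λ w → Neighbour w × E u w ≡ true × w ≢ c

    bad? : ∀ u → Dec (Bad u)
    bad? u = Finₚ.any? λ w → (E v w Boolₚ.≟ true) ×-dec (E u w Boolₚ.≟ true) ×-dec ¬? (w ≟ c)

    vu : ∀ {u} → u ∈ us₀ → Neighbour u
    vu i = proj₁ (All.lookup spokes i)

    cu : ∀ {u} → u ∈ us₀ → E c u ≡ true
    cu i = proj₂ (All.lookup spokes i)

    other : ∀ ys → length ys ≤ 4 → ∃ λ x → x ∈ us₀ × x ∉ ys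
    other ys l = fresh unique (≤-trans (s≤s l) many)

    -- One bad edge explains all bad spokes. With a spare spoke `u′`, a second bad spoke `u` gives
    -- the hexagon v w₁ u₁ u c u′ if `w` is `u₁`, the hexagon v u₁ w₁ u c u′ if `w` is `w₁`, and v
    -- w₁ u₁ c u w otherwise.
    bad-edge : ∀ {u₁ w₁} → u₁ ∈ us₀ → Neighbour w₁ → E u₁ w₁ ≡ true → w₁ ≢ c →
               ∀ {u} → u ∈ us₀ → u ≢ u₁ → u ≢ w₁ → ¬ Bad u
    bad-edge {u₁} {w₁} i₁ vw₁ u₁w₁ w₁≢c {u} i u≢u₁ u≢w₁ (w , vw , uw , w≢c) with w ≟ u₁ | w ≟ w₁
    ... | yes refl | _ with other (w₁ ∷ u₁ ∷ u ∷ []) (n≤1+n 3)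
    ...   | u′ , i′ , ∉ = hexagon vw₁ (adj-sym u₁w₁) (adj-sym uw) (adj-sym (cu i)) (cu i′) (adj-sym (vu i′))
      ( (adj⇒≢ vw₁ ∷ adj⇒≢ vw ∷ adj⇒≢ (vu i) ∷ ≢-sym c≢v ∷ adj⇒≢ (vu i′) ∷ [])
      ∷ (≢-sym (adj⇒≢ u₁w₁) ∷ ≢-sym u≢w₁ ∷ w₁≢c ∷ (λ { refl → ∉ (here refl) }) ∷ [])
      ∷ (≢-sym u≢u₁ ∷ w≢c ∷ (λ { refl → ∉ (there (here refl)) }) ∷ [])
      ∷ (≢-sym (adj⇒≢ (cu i)) ∷ (λ { refl → ∉ (there (there (here refl))) }) ∷ [])
      ∷ (adj⇒≢ (cu i′) ∷ [])
      ∷ [] ∷ [])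
    bad-edge {u₁} {w₁} i₁ vw₁ u₁w₁ w₁≢c {u} i u≢u₁ u≢w₁ (w , vw , uw , w≢c) | no w≢u₁ | yes refl
      with other (w₁ ∷ u₁ ∷ u ∷ []) (n≤1+n 3)
    ...   | u′ , i′ , ∉ = hexagon (vu i₁) u₁w₁ (adj-sym uw) (adj-sym (cu i)) (cu i′) (adj-sym (vu i′))
      ( (adj⇒≢ (vu i₁) ∷ adj⇒≢ vw ∷ adj⇒≢ (vu i) ∷ ≢-sym c≢v ∷ adj⇒≢ (vu i′) ∷ [])
      ∷ (adj⇒≢ u₁w₁ ∷ ≢-sym u≢u₁ ∷ ≢-sym (adj⇒≢ (cu i₁)) ∷ (λ { refl → ∉ (there (here refl)) }) ∷ [])
      ∷ (≢-sym u≢w₁ ∷ w≢c ∷ (λ { refl → ∉ (here refl) }) ∷ [])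
      ∷ (≢-sym (adj⇒≢ (cu i)) ∷ (λ { refl → ∉ (there (there (here refl))) }) ∷ [])
      ∷ (adj⇒≢ (cu i′) ∷ [])
      ∷ [] ∷ [])
    bad-edge {u₁} {w₁} i₁ vw₁ u₁w₁ w₁≢c {u} i u≢u₁ u≢w₁ (w , vw , uw , w≢c) | no w≢u₁ | no w≢w₁ =
      hexagon vw₁ (adj-sym u₁w₁) (adj-sym (cu i₁)) (cu i) uw (adj-sym vw)
      ( (adj⇒≢ vw₁ ∷ adj⇒≢ (vu i₁) ∷ ≢-sym c≢v ∷ adj⇒≢ (vu i) ∷ adj⇒≢ vw ∷ [])
      ∷ (≢-sym (adj⇒≢ u₁w₁) ∷ w₁≢c ∷ ≢-sym u≢w₁ ∷ ≢-sym w≢w₁ ∷ [])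
      ∷ (≢-sym (adj⇒≢ (cu i₁)) ∷ ≢-sym u≢u₁ ∷ ≢-sym w≢u₁ ∷ [])
      ∷ (adj⇒≢ (cu i) ∷ ≢-sym w≢c ∷ [])
      ∷ (adj⇒≢ uw ∷ [])
      ∷ [] ∷ [])

    Lonely : Fin n → Set
    Lonely u = ∀ {x} → Joined E (λ z → z ≢ v × z ≢ c) u x → Neighbour x → x ≡ u

    -- Stop a path from `u` at the first further neighbour `w` of `v`. If `w` is next to `u`, then
    -- `u` is bad. Otherwise v u′ c u ... w is a long cycle for a spare spoke `u′`, which cannot lie
    -- on the path because the inner vertices are not neighbours of `v`.
    good-lonely : ∀ {u} → u ∈ us₀ → ¬ Bad u → Lonely u
    good-lonely {u} i ¬bad {x} (_ , q , ps) vx with simplePath q ps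
    ... | _ , stop , _ = refl
    ... | _ , ux₁ ∷ r , u∉ ∷ ur , (u≢v , u≢c) ∷ rs with path-first (λ z → E v z Boolₚ.≟ true) r vx
    ...   | _ , _ , w , refl , stop , vw , _ = contradiction (w , vw , ux₁ , proj₂ (All.head rs)) ¬bad
    ...   | as , _ , w , refl , r′@(_ ∷ r″) , vw , first with other (u ∷ w ∷ []) (≤-trans (n≤1+n 2) (n≤1+n 3))
    ...     | u′ , i′ , ∉ = ⊥-elim (noLong (vu i′ ∷ adj-sym (cu i′) ∷ cu i ∷ ux₁ ∷ r′)
      ( (adj⇒≢ (vu i′) ∷ ≢-sym c≢v ∷ adj⇒≢ (vu i) ∷ All.map (≢-sym ∘ proj₁) rs′)
      ∷ (≢-sym (adj⇒≢ (cu i′)) ∷ (λ { refl → ∉ (here refl) }) ∷ All.map avoid first)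
      ∷ (≢-sym u≢c ∷ All.map (≢-sym ∘ proj₂) rs′)
      ∷ Allₚ.++⁻ˡ as u∉
      ∷ unique-++ˡ as ur)
      (adj-sym vw) (s≤s (s≤s (s≤s (s≤s (s≤s (∈ₚ.∈-length (source∈ r″))))))))
      where
      rs′ = Allₚ.++⁻ˡ as rs
      avoid : ∀ {z} → ¬ Neighbour z ⊎ z ≡ w → u′ ≢ z
      avoid (inj₁ ¬vz) refl = ¬vz (vu i′)
      avoid (inj₂ refl) refl = ∉ (there (here refl))

    -- The spoke `z` is held back from the leaves: its edge to `v` is not cut, so v z c is the
    -- detour that `Near` asks for. The loss of 3 is `z` and the two ends of a bad edge.
    Pruned : Set
    Pruned = ∃₂ λ z us → Unique (z ∷ us) × All (λ u → Neighbour u × E c u ≡ true × Lonely u) (z ∷ us) × length us₀ ≤ 3 + length us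

    reserve : ∀ us → Unique us → (∀ {u} → u ∈ us → u ∈ us₀) → (∀ {u} → u ∈ us → Lonely u) → length us₀ ≤ 2 + length us → Pruned
    reserve [] _ _ _ l = contradiction (≤-trans many l) λ { (s≤s (s≤s ())) }
    reserve (z ∷ us) uu sub lonely l = z , us , uu , All.tabulate (λ i → vu (sub i) , cu (sub i) , lonely i) , l

    prune : Pruned
    prune with Any.any? bad? us₀
    ... | no ¬any = reserve us₀ unique (λ i → i) (λ i → good-lonely i λ b → ¬any (Any.map (λ { refl → b }) i)) (m≤n+m (length us₀) 2)
    ... | yes any with find any
    -- By `bad-edge`, discarding both ends of one bad edge removes every bad spoke.
    ...   | u₁ , i₁ , w₁ , vw₁ , u₁w₁ , w₁≢c = reserve rest (Uniqueₚ.filter⁺ w₁? (Uniqueₚ.filter⁺ u₁? unique))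
              (λ i → proj₁ (∈ₚ.∈-filter⁻ u₁? (proj₁ (∈ₚ.∈-filter⁻ w₁? i)))) lonely
              (≤-trans (length-remove u₁ unique) (s≤s (length-remove w₁ (Uniqueₚ.filter⁺ u₁? unique))))
      where
      u₁? = λ x → ¬? (x ≟ u₁)
      w₁? = λ x → ¬? (x ≟ w₁)
      rest = filter w₁? (filter u₁? us₀)
      lonely : ∀ {u} → u ∈ rest → Lonely u
      lonely i with ∈ₚ.∈-filter⁻ w₁? i
      ... | j , u≢w₁ with ∈ₚ.∈-filter⁻ u₁? j
      ...   | k , u≢u₁ = good-lonely k (bad-edge i₁ vw₁ u₁w₁ w₁≢c k u≢u₁ u≢w₁)

  component : Fin n → VSet n
  component = reached joined₁?

  component-closed : ∀ {c x y} → component c x ≡ true → E x y ≡ true → component c y ≡ true ⊎ y ≡ v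
  component-closed {c} {x} {y} h e with y ≟ v
  ... | yes q  = inj₂ q
  ... | no y≢v = inj₁ (⇒does (joined₁? c y) (joined-trans j (joined-edge e (joined-target j) y≢v)))
    where j = does⇒ (joined₁? c x) h

  root∉component : ∀ c → component c v ≡ false
  root∉component c = ≢true⇒false λ h → joined-target (does⇒ (joined₁? c v) h) refl

  barePiece : ∀ {a} → Neighbour a → IsPiece E v (piece (component a) a [])
  barePiece {a} va = record
    { root∉     = root∉component a
    ; anchor∈   = ⇒does (joined₁? a a) (joined-refl (≢-sym (adj⇒≢ va)))
    ; closed    = component-closed
    ; connected = reached-connected joined₁? a
    ; near      = inj₁ va
    ; areLeaves = []
    ; disjoint  = []
    }

  module _ {c : Fin n} (c≢v : c ≢ v) where

    branch : Fin n → VSet n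
    branch = reached (joined₂? c)

    leafOf : Fin n → Fin n × VSet n
    leafOf u = u , branch u

    Spoke : Fin n → Set
    Spoke u = Neighbour u × E c u ≡ true × (∀ {x} → Joined E (λ z → z ≢ v × z ≢ c) u x → Neighbour x → x ≡ u)

    private
      off : ∀ {u} → Spoke u → u ≢ v × u ≢ c
      off (vu , cu , _) = ≢-sym (adj⇒≢ vu) , ≢-sym (adj⇒≢ cu)

      joinedTo : ∀ {u x} → branch u x ≡ true → Joined E (λ z → z ≢ v × z ≢ c) u x
      joinedTo {u} {x} = does⇒ (joined₂? c u x)

      missed : ∀ {u w} → Spoke u → Neighbour w → u ≢ w → branch u w ≡ false
      missed (_ , _ , lonely) vw u≢w = ≢true⇒false λ h → u≢w (sym (lonely (joinedTo h) vw))

    -- Loneliness makes `u` the only vertex of its branch next to `v`, which is the last alternative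
    -- of `closed`.
    leafOf-isLeaf : ∀ {u} → Spoke u → IsLeaf E v c (component c) (leafOf u)
    leafOf-isLeaf {u} s@(vu , cu , lonely) = record
      { self        = ⇒does (joined₂? c u u) (joined-refl (off s))
      ; away        = ≢true⇒false λ h → proj₂ (joined-target (joinedTo h)) refl
      ; inside      = λ {x} h → let (xs , q , ps) = joinedTo h in
                      ⇒does (joined₁? c x) (c ∷ xs , cu ∷ q , c≢v ∷ All.map proj₁ ps)
      ; root-edge   = vu
      ; anchor-edge = cu
      ; closed      = closed′
      ; connected   = reached-connected (joined₂? c) u
      }
      where
      closed′ : ∀ {x y} → branch u x ≡ true → E x y ≡ true → branch u y ≡ true ⊎ y ≡ c ⊎ (y ≡ v × x ≡ u)
      closed′ {x} {y} h e with y ≟ c | y ≟ v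
      ... | yes q  | _        = inj₂ (inj₁ q)
      ... | no _   | yes refl = inj₂ (inj₂ (refl , lonely (joinedTo h) (adj-sym e)))
      ... | no y≢c | no y≢v   = inj₁ (⇒does (joined₂? c u y)
        (joined-trans (joinedTo h) (joined-edge e (joined-target (joinedTo h)) (y≢v , y≢c))))

    spokes-disjoint : ∀ {us} → Unique us → All Spoke us → AllPairs DisjointLeaves (map leafOf us)
    spokes-disjoint [] [] = []
    spokes-disjoint (u≢ ∷ uu) (s ∷ ss) =
      Allₚ.map⁺ (All.zipWith apart (u≢ , ss)) ∷ spokes-disjoint uu ss
      where
      apart : ∀ {w} → _ ≢ w × Spoke w → DisjointLeaves (leafOf _) (leafOf w)
      apart {w} (u≢w , t) x h k = u≢w (sym (proj₂ (proj₂ s) (joined-trans (joinedTo h) (joined-sym S (joinedTo k))) (proj₁ t)))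

    starPiece : ∀ {z us} → Unique (z ∷ us) → All Spoke (z ∷ us) → IsPiece E v (piece (component c) c (map leafOf us))
    starPiece {z} {us} (z≢ ∷ uu) (s@(vz , cz , _) ∷ ss) = record
      { root∉     = root∉component c
      ; anchor∈   = ⇒does (joined₁? c c) (joined-refl c≢v)
      ; closed    = component-closed
      ; connected = reached-connected joined₁? c
      ; near      = inj₂ (z , ⇒does (joined₁? c z) (joined-edge cz c≢v (proj₁ (off s))) , vz , adj-sym cz ,
                          Allₚ.map⁺ (All.zipWith (λ (z≢u , t) → missed t vz (≢-sym z≢u)) (z≢ , ss)))
      ; areLeaves = Allₚ.map⁺ (All.map leafOf-isLeaf ss)
      ; disjoint  = spokes-disjoint uu ss
      }

  PieceAt : Fin n → ℕ → Set
  PieceAt a k = ∃ λ P → IsPiece E v P × (∀ {x} → region P x ≡ true → Joined E (_≢ v) a x) × k ≤ 13 * suc (length (leaves P))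

  findPiece : ∀ {a ws} (va : Neighbour a) → Unique ws → All (FindHub.Mate a va) ws → PieceAt a (suc (length ws))
  findPiece {a} {ws} va u ms with FindHub.findHub a va ws u ms
  ... | c , us₀ , ac , hub , l with 5 ≤? length us₀
  -- At most four spokes leave at most 12 mates. With `a` these are 13 neighbours for one anchor,
  -- and this is the origin of 13.
  ...   | no ¬5 = piece (component a) a [] , barePiece va , (λ {x} → does⇒ (joined₁? a x)) ,
                  s≤s (≤-trans l (*-monoʳ-≤ 3 (≤-pred (≰⇒> ¬5))))
  ...   | yes many with Prune.prune hub many
  ...     | z , us , uu , ss , l′ =
    _ , starPiece c≢v uu ss , (λ {x} h → joined-trans ac (does⇒ (joined₁? c x) h)) ,
    subst (λ k → suc (length ws) ≤ 13 * suc k) (sym (Listₚ.length-map (leafOf c≢v) us)) (begin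
      suc (length ws)           ≤⟨ s≤s l ⟩
      suc (3 * length us₀)      ≤⟨ s≤s (*-monoʳ-≤ 3 l′) ⟩
      suc (3 * (3 + length us)) ≡⟨ cong suc (*-distribˡ-+ 3 3 (length us)) ⟩
      10 + 3 * length us        ≤⟨ +-mono-≤ (m≤m+n 10 3) (*-monoˡ-≤ (length us) (m≤m+n 3 10)) ⟩
      13 + 13 * length us       ≡⟨ sym (*-suc 13 (length us)) ⟩
      13 * suc (length us)      ∎)
    where
    open Hub hub
    open ≤-Reasoning

  -- Recording that each region is reached from `ns` makes the recursion work: a region reached from
  -- vertices not joined to `a` is disjoint from the piece found at `a`.
  PlanFor : List (Fin n) → Set
  PlanFor ns = ∃ λ Ps → IsPlan E v Ps × All (λ P → ∀ x → region P x ≡ true → ∃ λ w → w ∈ ns × Joined E (_≢ v) w x) Ps ×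
               length ns ≤ 13 * size (map outline Ps)

  findPlan : ∀ k ns → length ns ≤ k → Unique ns → All Neighbour ns → PlanFor ns
  findPlan _ [] _ _ _ = [] , plan [] [] , [] , z≤n
  findPlan (suc k) (a ∷ ns) (s≤s l) (a≢ ∷ u) (va ∷ vs)
    with findPiece va (Uniqueₚ.filter⁺ (joined₁? a) u)
           (All.zipWith (λ ((vw , a≢w) , j) → vw , ≢-sym a≢w , j)
             (Allₚ.filter⁺ (joined₁? a) (All.zip (vs , a≢)) , Allₚ.all-filter (joined₁? a) ns))
       | findPlan k (filter (¬? ∘ joined₁? a) ns) (≤-trans (Listₚ.length-filter (¬? ∘ joined₁? a) ns) l)
           (Uniqueₚ.filter⁺ (¬? ∘ joined₁? a) u) (Allₚ.filter⁺ (¬? ∘ joined₁? a) vs)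
  ... | P , isP , reachP , lP | Ps , plan isPs disj , reachPs , lPs =
    P ∷ Ps , plan (isP ∷ isPs) (All.map (λ {Q} → apart {Q}) reachPs ∷ disj) ,
    (λ x h → a , here refl , reachP h) ∷
      All.map (λ {Q} → widen {Q}) reachPs ,
    count
    where
    open ≤-Reasoning
    mates = filter (joined₁? a) ns
    rest = filter (¬? ∘ joined₁? a) ns
    widen : ∀ {Q : Piece n} → (∀ x → region Q x ≡ true → ∃ λ w → w ∈ rest × Joined E (_≢ v) w x) →
            ∀ x → region Q x ≡ true → ∃ λ w → w ∈ a ∷ ns × Joined E (_≢ v) w x
    widen r x h with r x h
    ... | w , i , j = w , there (proj₁ (∈ₚ.∈-filter⁻ (¬? ∘ joined₁? a) {xs = ns} i)) , j
    apart : ∀ {Q} → (∀ x → region Q x ≡ true → ∃ λ w → w ∈ rest × Joined E (_≢ v) w x) → DisjointPieces P Q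
    apart r x Px Qx with r x Qx
    ... | w , i , j = proj₂ (∈ₚ.∈-filter⁻ (¬? ∘ joined₁? a) {xs = ns} i) (joined-trans (reachP Px) (joined-sym S j))
    count : suc (length ns) ≤ 13 * suc (length (leafVertices P) + size (map outline Ps))
    count = begin
      suc (length ns)                                              ≡⟨ cong suc (length-filter-split (joined₁? a) ns) ⟩
      suc (length mates) + length rest                             ≤⟨ +-mono-≤ lP lPs ⟩
      13 * suc (length (leaves P)) + 13 * size (map outline Ps)    ≡⟨ sym (*-distribˡ-+ 13 (suc (length (leaves P))) (size (map outline Ps))) ⟩
      13 * suc (length (leaves P) + size (map outline Ps))         ≡⟨ cong (λ k → 13 * suc (k + size (map outline Ps))) (sym (Listₚ.length-map proj₁ (leaves P))) ⟩
      13 * suc (length (leafVertices P) + size (map outline Ps))   ∎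

-- Cutting a plan down to a prescribed size

module _ {n} {E : Graph n} {p : Fin n} where

  trim : ℕ → Piece n → Piece n
  trim k P = piece (region P) (anchor P) (take k (leaves P))

  trim-isPiece : ∀ k {P} → IsPiece E p P → IsPiece E p (trim k P)
  trim-isPiece k {P} isP = record
    { root∉     = root∉
    ; anchor∈   = anchor∈
    ; closed    = closed
    ; connected = connected
    ; near      = near-map {E = E} {p} {region P} {anchor P} (Allₚ.take⁺ k) near
    ; areLeaves = Allₚ.take⁺ k areLeaves
    ; disjoint  = AllPairsₚ.take⁺ k disjoint
    }
    where
    open IsPiece isP

  -- With the exact size m, the number of steps and the number of candidates are the same for all
  -- graphs. Dropping pieces, or leaves of a piece, leaves a plan.
  trimPlan : ∀ m Ps → IsPlan E p Ps → m ≤ size (map outline Ps) →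
             ∃ λ Qs → IsPlan E p Qs × size (map outline Qs) ≡ m × All (λ Q → ∃ λ P → P ∈ Ps × region Q ≡ region P) Qs
  trimPlan zero    Ps isPs _ = [] , plan [] [] , refl , []
  trimPlan (suc m) (P ∷ Ps) (plan (isP ∷ isPs) (d ∷ ds)) (s≤s l) with m ≤? length (leafVertices P)
  ... | yes m≤ = trim m P ∷ [] , plan (trim-isPiece m isP ∷ []) ([] ∷ []) ,
                 cong suc (trans (+-identityʳ _) (trans (Listₚ.length-map proj₁ (take m (leaves P)))
                   (trans (Listₚ.length-take m (leaves P)) (m≤n⇒m⊓n≡m (≤-trans m≤ (≤-reflexive (Listₚ.length-map proj₁ (leaves P)))))))) ,
                 (P , here refl , refl) ∷ []
  ... | no m≰ with trimPlan (m ∸ length (leafVertices P)) Ps (plan isPs ds)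
                     (≤-trans (∸-monoˡ-≤ (length (leafVertices P)) l) (≤-reflexive (m+n∸m≡n (length (leafVertices P)) (size (map outline Ps)))))
  ...   | Qs , plan isQs dq , eq , from =
    P ∷ Qs , plan (isP ∷ isQs) (All.map (λ {Q} → disj {Q}) from ∷ dq) ,
    cong suc (trans (cong (length (leafVertices P) +_) eq) (m+[n∸m]≡n (≰⇒≥ m≰))) ,
    (P , here refl , refl) ∷ All.map (λ (Q , i , q) → Q , there i , q) from
    where
    disj : ∀ {Q} → (∃ λ P′ → P′ ∈ Ps × region Q ≡ region P′) → DisjointPieces P Q
    disj (P′ , i , eq) x Px Qx = All.lookup d i x Px (trans (sym (cong (λ f → f x) eq)) Qx)

-- Counting arrangements

length-concatMap : ∀ {A B : Set} {f : A → List B} {c} xs → (∀ {x} → x ∈ xs → length (f x) ≡ c) → length (concatMap f xs) ≡ length xs * c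
length-concatMap [] _ = refl
length-concatMap {f = f} (x ∷ xs) h =
  trans (Listₚ.length-++ (f x)) (cong₂ _+_ (h (here refl)) (length-concatMap xs (h ∘ there)))

unique-concatMap : ∀ {A B : Set} {f : A → List B} {xs} → Unique xs → (∀ {x} → x ∈ xs → Unique (f x)) →
                   (∀ {x x′ y} → x ∈ xs → x′ ∈ xs → y ∈ f x → y ∈ f x′ → x ≡ x′) → Unique (concatMap f xs)
unique-concatMap [] _ _ = []
unique-concatMap {f = f} {xs = x ∷ xs} (x≢ ∷ u) uf inj =
  Uniqueₚ.++⁺ (uf (here refl)) (unique-concatMap u (uf ∘ there) (λ i j → inj (there i) (there j))) λ (i , j) →
    let (x′ , i′ , k) = find (∈ₚ.∈-concatMap⁻ f {xs = xs} j) in All.lookup x≢ i′ (inj (here refl) (there i′) i k)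

∈-concatMap-find : ∀ {A B : Set} (f : A → List B) xs {y} → y ∈ concatMap f xs → ∃ λ x → x ∈ xs × y ∈ f x
∈-concatMap-find f xs i = find (∈ₚ.∈-concatMap⁻ f {xs = xs} i)

∈-concatMap-intro : ∀ {A B : Set} (f : A → List B) {x xs y} → x ∈ xs → y ∈ f x → y ∈ concatMap f xs
∈-concatMap-intro f i j = ∈ₚ.∈-concatMap⁺ f (Any.map (λ { refl → j }) i)

module _ {B : Set} where

  inserts : B → List B → List (List B)
  inserts b []       = (b ∷ []) ∷ []
  inserts b (y ∷ ys) = (b ∷ y ∷ ys) ∷ map (y ∷_) (inserts b ys)

  length-inserts : ∀ b ys → length (inserts b ys) ≡ suc (length ys)
  length-inserts b []       = refl
  length-inserts b (y ∷ ys) = cong suc (trans (Listₚ.length-map (y ∷_) (inserts b ys)) (length-inserts b ys))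

  inserts-↭ : ∀ {b} ys {zs} → zs ∈ inserts b ys → b ∷ ys ↭ zs
  inserts-↭ []       (here refl) = ↭-refl
  inserts-↭ (y ∷ ys) (here refl) = ↭-refl
  inserts-↭ {b} (y ∷ ys) (there i) with ∈ₚ.∈-map⁻ (y ∷_) i
  ... | zs , j , refl = ↭-trans (_↭_.swap b y ↭-refl) (_↭_.prep y (inserts-↭ ys j))

  unique-inserts : ∀ {b} ys → b ∉ ys → Unique (inserts b ys)
  unique-inserts []       _  = [] ∷ []
  unique-inserts {b} (y ∷ ys) b∉ =
    All.tabulate (λ i eq → let (_ , _ , q) = ∈ₚ.∈-map⁻ (y ∷_) i in b∉ (here (Listₚ.∷-injectiveˡ (trans eq q))))
    ∷ Uniqueₚ.map⁺ Listₚ.∷-injectiveʳ (unique-inserts ys (b∉ ∘ there))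

module _ {n : ℕ} {B : Set} (key : B → Fin n) where

  -- One element is chosen from each list, and the chosen elements are put in any order.
  arrangements : List (Fin n × List B) → List (List B)
  arrangements []              = [] ∷ []
  arrangements ((_ , bs) ∷ cs) = concatMap (λ b → concatMap (inserts b) (arrangements cs)) bs

  weight : List (Fin n × List B) → ℕ
  weight []              = 1
  weight ((_ , bs) ∷ cs) = length bs * (weight cs * suc (length cs))

  ∈-arrangements⁻ : ∀ cs {zs} → zs ∈ arrangements cs → ∃ λ bs → Pointwise (λ b c → b ∈ proj₂ c) bs cs × bs ↭ zs
  ∈-arrangements⁻ [] (here refl) = [] , [] , ↭-refl
  ∈-arrangements⁻ ((_ , bs) ∷ cs) i with ∈-concatMap-find _ bs i
  ... | b , j , k with ∈-concatMap-find _ (arrangements cs) k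
  ...   | ys , l , m with ∈-arrangements⁻ cs l
  ...     | bs′ , h , σ = b ∷ bs′ , j ∷ h , ↭-trans (_↭_.prep b σ) (inserts-↭ ys m)

  length-arrangements : ∀ cs → length (arrangements cs) ≡ weight cs
  length-arrangements [] = refl
  length-arrangements ((_ , bs) ∷ cs) = length-concatMap bs λ {b} _ →
    trans (length-concatMap {c = suc (length cs)} (arrangements cs) λ {ys} i → trans (length-inserts b ys) (cong suc (len i)))
          (cong (_* suc (length cs)) (length-arrangements cs))
    where
    len : ∀ {ys} → ys ∈ arrangements cs → length ys ≡ length cs
    len i with ∈-arrangements⁻ cs i
    ... | bs , h , σ = trans (sym (↭-length σ)) (Pointwise-length h)

  Keyed : Fin n × List B → Set
  Keyed (k , bs) = Unique bs × All (λ b → key b ≡ k) bs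

  private
    keys∈ : ∀ {cs} → All Keyed cs → ∀ {zs} → zs ∈ arrangements cs → All (λ b → key b ∈ map proj₁ cs) zs
    keys∈ {cs} ks i with ∈-arrangements⁻ cs i
    ... | bs , h , σ = All-resp-↭ σ (go ks h)
      where
      go : ∀ {cs bs} → All Keyed cs → Pointwise (λ b c → b ∈ proj₂ c) bs cs → All (λ b → key b ∈ map proj₁ cs) bs
      go [] [] = []
      go ((_ , k) ∷ ks) (j ∷ h) = here (All.lookup k j) ∷ All.map there (go ks h)

    module _ (k : Fin n) where

      at? : ∀ b → Dec (key b ≡ k)
      at? b = key b ≟ k

      select-none : ∀ {ys} → All (λ b → key b ≢ k) ys → filter at? ys ≡ [] × filter (¬? ∘ at?) ys ≡ ys
      select-none h = Listₚ.filter-none at? h , Listₚ.filter-all (¬? ∘ at?) h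

      select-insert : ∀ {b ys zs} → key b ≡ k → All (λ b → key b ≢ k) ys → zs ∈ inserts b ys →
                      filter at? zs ≡ b ∷ [] × filter (¬? ∘ at?) zs ≡ ys
      select-insert {b} {[]} kb [] (here refl) with key b ≟ k
      ... | yes _ = refl , refl
      ... | no ¬q = contradiction kb ¬q
      select-insert {b} {y ∷ ys} kb h (here refl) with key b ≟ k
      ... | yes _ = let (p , q) = select-none h in cong (b ∷_) p , q
      ... | no ¬q = contradiction kb ¬q
      select-insert {b} {y ∷ ys} kb (ky ∷ h) (there i) with ∈ₚ.∈-map⁻ (y ∷_) i
      ... | zs , j , refl with key y ≟ k | select-insert kb h j
      ...   | yes q | _     = contradiction q ky
      ...   | no _  | p , q = p , cong (y ∷_) q

  -- Filtering an arrangement by the first key returns the chosen element, and the complementary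
  -- filter returns the arrangement into which it was inserted. So nothing is produced twice.
  unique-arrangements : ∀ cs → Unique (map proj₁ cs) → All Keyed cs → Unique (arrangements cs)
  unique-arrangements [] _ _ = [] ∷ []
  unique-arrangements ((k , bs) ∷ cs) (k≢ ∷ u) ((ub , kb) ∷ ks) =
    unique-concatMap ub
      (λ i → unique-concatMap (unique-arrangements cs u ks)
        (λ j → unique-inserts _ λ b∈ → All.lookup (off j) b∈ (All.lookup kb i))
        (λ j j′ y y′ → trans (sym (proj₂ (select-insert k (All.lookup kb i) (off j) y))) (proj₂ (select-insert k (All.lookup kb i) (off j′) y′))))
      same
    where
    off : ∀ {ys} → ys ∈ arrangements cs → All (λ b → key b ≢ k) ys
    off j = All.map (λ i q → All.lookup k≢ i (sym q)) (keys∈ ks j)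
    same : ∀ {b b′ y} → b ∈ bs → b′ ∈ bs → y ∈ concatMap (inserts b) (arrangements cs) → y ∈ concatMap (inserts b′) (arrangements cs) → b ≡ b′
    same i i′ y y′ with ∈-concatMap-find _ (arrangements cs) y | ∈-concatMap-find _ (arrangements cs) y′
    ... | _ , j , l | _ , j′ , l′ = Listₚ.∷-injectiveˡ
      (trans (sym (proj₁ (select-insert k (All.lookup kb i) (off j) l))) (proj₁ (select-insert k (All.lookup kb i′) (off j′) l′)))

module _ {n : ℕ} where

  only : Fin n → Fin n × List (Fin n)
  only u = u , u ∷ []

  -- With a single choice per list, only the order remains. Count and distinctness are thus
  -- inherited from arrangements.
  permutations : List (Fin n) → List (List (Fin n))
  permutations us = arrangements id (map only us)

  length-permutations : ∀ us → length (permutations us) ≡ length us !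
  length-permutations us = trans (length-arrangements id (map only us)) (go us)
    where
    go : ∀ us → weight id (map only us) ≡ length us !
    go [] = refl
    go (u ∷ us) = trans (+-identityʳ _) (trans (cong₂ _*_ (go us) (cong suc (Listₚ.length-map only us)))
      (*-comm (length us !) (suc (length us))))

  permutations-↭ : ∀ us {ws} → ws ∈ permutations us → us ↭ ws
  permutations-↭ us i with ∈-arrangements⁻ id (map only us) i
  ... | bs , h , σ = ↭-trans (↭-reflexive (go us h)) σ
    where
    go : ∀ us {bs} → Pointwise (λ b (c : Fin n × List (Fin n)) → b ∈ proj₂ c) bs (map only us) → us ≡ bs
    go [] [] = refl
    go (u ∷ us) (here refl ∷ h) = cong (u ∷_) (go us h)

  unique-permutations : ∀ {us} → Unique us → Unique (permutations us)
  unique-permutations {us} u = unique-arrangements id (map only us)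
    (subst Unique (trans (sym (Listₚ.map-id us)) (Listₚ.map-∘ us)) u)
    (Allₚ.map⁺ (All.tabulate λ _ → [] ∷ [] , refl ∷ []))

  choices : Fin n × List (Fin n) → Fin n × List (Fin n × List (Fin n))
  choices (c , us) = c , map (c ,_) (permutations us)

  orders : Skeleton n → List (Skeleton n)
  orders s = arrangements proj₁ (map choices s)

  -- This is q! ∏ rᵢ!, where q! is built from the number of places at which each piece can be
  -- inserted.
  orderCount : Skeleton n → ℕ
  orderCount []             = 1
  orderCount ((_ , us) ∷ s) = length us ! * (orderCount s * suc (length s))

  length-orders : ∀ s → length (orders s) ≡ orderCount s
  length-orders s = trans (length-arrangements proj₁ (map choices s)) (go s)
    where
    go : ∀ s → weight proj₁ (map choices s) ≡ orderCount s
    go [] = refl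
    go ((c , us) ∷ s) = cong₂ _*_ (trans (Listₚ.length-map (c ,_) (permutations us)) (length-permutations us))
      (cong₂ _*_ (go s) (cong suc (Listₚ.length-map choices s)))

  unique-orders : ∀ {s} → Unique (map proj₁ s) → All (Unique ∘ proj₂) s → Unique (orders s)
  unique-orders {s} u us = unique-arrangements proj₁ (map choices s) (subst Unique (Listₚ.map-∘ s) u)
    (Allₚ.map⁺ (All.map (λ {(c , _)} u → Uniqueₚ.map⁺ (λ { refl → refl }) (unique-permutations u) ,
                                          Allₚ.map⁺ (All.tabulate λ _ → refl)) us))

module _ {n : ℕ} {E : Graph n} {p : Fin n} where

  plan-unique : ∀ {Ps} → IsPlan E p Ps → Unique (map proj₁ (map outline Ps)) × All (Unique ∘ proj₂) (map outline Ps)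
  plan-unique {Ps} (plan isPs disj) =
    subst Unique (Listₚ.map-∘ Ps) (distinct anchor region (All.map (λ isP → IsPiece.anchor∈ isP) isPs) disj) ,
    Allₚ.map⁺ (All.map (λ isP → distinct proj₁ proj₂ (All.map (λ isL → IsLeaf.self isL) (IsPiece.areLeaves isP)) (IsPiece.disjoint isP)) isPs)
    where
    distinct : ∀ {A : Set} (pt : A → Fin n) (set : A → VSet n) {xs} → All (λ x → set x (pt x) ≡ true) xs →
               AllPairs (λ x y → Disjoint (set x) (set y)) xs → Unique (map pt xs)
    distinct pt set [] [] = []
    distinct pt set (h ∷ hs) (d ∷ ds) =
      Allₚ.map⁺ (All.zipWith (λ (k , e) eq → e _ h (subst (λ z → set _ z ≡ true) (sym eq) k)) (hs , d)) ∷ distinct pt set hs ds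

  reorderLeaves : ∀ {P ws} → IsPiece E p P → leafVertices P ↭ ws →
                  ∃ λ Q → IsPiece E p Q × region Q ≡ region P × outline Q ≡ (anchor P , ws)
  reorderLeaves {P} isP σ with ↭-map-inv proj₁ σ
  ... | ls , refl , τ = piece (region P) (anchor P) ls , record
    { root∉     = root∉
    ; anchor∈   = anchor∈
    ; closed    = closed
    ; connected = connected
    ; near      = near-map {E = E} {p} {region P} {anchor P} (All-resp-↭ τ) near
    ; areLeaves = All-resp-↭ τ areLeaves
    ; disjoint  = AllPairs-resp-↭ (λ d x h k → d x k h) τ disjoint
    } , refl , refl
    where
    open IsPiece isP

  -- No condition on a plan depends on the order of pieces or leaves. Rebuilding the pieces keeps
  -- their regions, and disjointness is transported along this equality.
  reorder : ∀ {Ps s} → IsPlan E p Ps → s ∈ orders (map outline Ps) → ∃ λ Qs → IsPlan E p Qs × map outline Qs ≡ s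
  reorder {Ps} isPs i with ∈-arrangements⁻ proj₁ (map choices (map outline Ps)) i
  ... | bs , h , σ with go isPs h
    where
    go : ∀ {Ps bs} → IsPlan E p Ps → Pointwise (λ b (c : Fin n × List (Fin n × List (Fin n))) → b ∈ proj₂ c) bs (map choices (map outline Ps)) →
         ∃ λ Qs → IsPlan E p Qs × map outline Qs ≡ bs × map region Qs ≡ map region Ps
    go {[]} _ [] = [] , plan [] [] , refl , refl
    go {P ∷ Ps} (plan (isP ∷ isPs) (d ∷ ds)) (j ∷ h) with go (plan isPs ds) h | ∈ₚ.∈-map⁻ (anchor P ,_) j
    ... | Qs , plan isQs dq , eq , eqr | ws , k , refl with reorderLeaves isP (permutations-↭ (leafVertices P) k)
    ...   | Q , isQ , r , o = Q ∷ Qs ,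
      plan (isQ ∷ isQs) (subst (λ K → All (λ Q′ → Disjoint K (region Q′)) Qs) (sym r)
                          (Allₚ.map⁻ (subst (All (Disjoint (region P))) (sym eqr) (Allₚ.map⁺ d))) ∷ dq) ,
      cong₂ _∷_ o eq , cong₂ _∷_ r eqr
  ...   | Qs , plan isQs dq , refl , _ with ↭-map-inv outline σ
  ...     | Rs , eq , τ = Rs , plan (All-resp-↭ τ isQs) (AllPairs-resp-↭ (λ d x h k → d x k h) τ dq) , sym eq

-- Recovering the skeleton from the new graph and the two ends

words : ℕ → List (List (Fin 3))
words zero    = [] ∷ []
words (suc k) = concatMap (λ s → map (s ∷_) (words k)) (allFin 3)

length-words : ∀ k → length (words k) ≡ 3 ^ k
length-words zero    = refl
length-words (suc k) = length-concatMap {f = λ s → map (s ∷_) (words k)} (allFin 3) λ {s} _ → trans (Listₚ.length-map (s ∷_) (words k)) (length-words k)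

words-∷ : ∀ k {w} s → w ∈ words k → (s ∷ w) ∈ words (suc k)
words-∷ k s i = ∈-concatMap-intro (λ s → map (s ∷_) (words k)) (∈ₚ.∈-allFin s) (∈ₚ.∈-map⁺ (s ∷_) i)

module _ {n : ℕ} where

  shortPaths : ℕ → Graph n → Fin n → Fin n → List (List (Fin n))
  shortPaths zero    E x e = []
  shortPaths (suc k) E x e =
    (if does (x ≟ e) then (x ∷ []) ∷ [] else []) ++
    concatMap (λ y → if E x y then map (x ∷_) (shortPaths k E y e) else []) (allFin n)

  shortPaths-sound : ∀ k {E x e xs} → xs ∈ shortPaths k E x e → Path E x xs e × length xs ≤ k
  shortPaths-sound (suc k) {E} {x} {e} i with ∈ₚ.∈-++⁻ (if does (x ≟ e) then (x ∷ []) ∷ [] else []) i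
  ... | inj₁ j with x ≟ e | j
  ...   | yes refl | here refl = stop , s≤s z≤n
  shortPaths-sound (suc k) {E} {x} {e} i | inj₂ j with ∈-concatMap-find _ (allFin n) j
  ... | y , _ , l with E x y in eq | l
  ...   | true | l with ∈ₚ.∈-map⁻ (x ∷_) l
  ...     | ys , m , refl = let (q , b) = shortPaths-sound k m in eq ∷ q , s≤s b

  shortPaths-complete : ∀ k {E x e xs} → Path E x xs e → length xs ≤ k → xs ∈ shortPaths k E x e
  shortPaths-complete (suc k) {x = x} stop _ with x ≟ x
  ... | yes _ = here refl
  ... | no ¬q = contradiction refl ¬q
  shortPaths-complete (suc k) {E} {x} {e} (_∷_ {y = y} {xs = xs} d q) (s≤s l) =
    ∈ₚ.∈-++⁺ʳ (if does (x ≟ e) then (x ∷ []) ∷ [] else []) (∈-concatMap-intro _ (∈ₚ.∈-allFin y) member)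
    where
    member : (x ∷ xs) ∈ (if E x y then map (x ∷_) (shortPaths k E y e) else [])
    member rewrite d = ∈ₚ.∈-map⁺ (x ∷_) (shortPaths-complete k q l)

  firstOr[] : List (List (Fin n)) → List (Fin n)
  firstOr[] []       = []
  firstOr[] (xs ∷ _) = xs

  -- Any path will do, because all of them visit the skeleton in order. What counts is that it
  -- depends only on the bound, the new graph and the two ends.
  canonicalPath : ℕ → Graph n → Fin n → Fin n → List (Fin n)
  canonicalPath k E x e = firstOr[] (shortPaths k E x e)

  canonicalPath-path : ∀ k {E x e xs} → Path E x xs e → length xs ≤ k →
                       Path E x (canonicalPath k E x e) e × length (canonicalPath k E x e) ≤ k
  canonicalPath-path k {E} {x} {e} q l with shortPaths k E x e | shortPaths-complete k q l | (λ {xs} → shortPaths-sound k {E} {x} {e} {xs})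
  ... | ys ∷ _ | _ | sound = sound (here refl)

  -- Symbol 0 skips a vertex, 1 makes it an anchor, and 2 a leaf of the last anchor before it.
  parse : List (Fin n) → List (Fin 3) → List (Fin n) × Skeleton n
  parse []       _        = [] , []
  parse (x ∷ xs) []       = [] , []
  parse (x ∷ xs) (0F ∷ w) = parse xs w
  parse (x ∷ xs) (1F ∷ w) = [] , (x , proj₁ (parse xs w)) ∷ proj₂ (parse xs w)
  parse (x ∷ xs) (2F ∷ w) = x ∷ proj₁ (parse xs w) , proj₂ (parse xs w)

  parse-complete : ∀ k us s {xs} → (us ++ flat s) ⊆ xs → length xs ≤ k → ∃ λ w → w ∈ words k × parse xs w ≡ (us , s)
  -- Words have length exactly `k`, so when the path is shorter the rest is filled with skips.
  parse-complete k [] [] {[]} _ _ = replicate k 0F , skips k , refl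
    where
    skips : ∀ k → replicate k 0F ∈ words k
    skips zero    = here refl
    skips (suc k) = words-∷ k 0F (skips k)
  parse-complete (suc k) us s (y ∷ʳ τ) (s≤s l) with parse-complete k us s τ l
  ... | w , i , eq = 0F ∷ w , words-∷ k 0F i , eq
  parse-complete (suc k) [] ((c , us) ∷ s) (refl ∷ τ) (s≤s l) with parse-complete k us s τ l
  ... | w , i , eq = 1F ∷ w , words-∷ k 1F i , cong (λ (us , s) → [] , (c , us) ∷ s) eq
  parse-complete (suc k) (u ∷ us) s (refl ∷ τ) (s≤s l) with parse-complete k us s τ l
  ... | w , i , eq = 2F ∷ w , words-∷ k 2F i , cong (λ (us , s) → u ∷ us , s) eq

  candidatesBetween : ℕ → Graph n → Fin n → Fin n → List (Fin n × Skeleton n)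
  candidatesBetween k F v e = map (λ w → v , proj₂ (parse (canonicalPath k F v e) w)) (words k)

  candidates : ℕ → Graph n → List (Fin n × Skeleton n)
  candidates k F = concatMap (λ v → concatMap (candidatesBetween k F v) (allFin n)) (allFin n)

  length-allFin : length (allFin n) ≡ n
  length-allFin = Listₚ.length-tabulate id

  length-candidates : ∀ k F → length (candidates k F) ≡ n * (n * 3 ^ k)
  length-candidates k F = trans
    (length-concatMap (allFin n) λ {v} _ → trans
      (length-concatMap (allFin n) λ {e} _ → trans (Listₚ.length-map (λ w → v , proj₂ (parse (canonicalPath k F v e) w)) (words k)) (length-words k))
      (cong (_* 3 ^ k) length-allFin))
    (cong (_* (n * 3 ^ k)) length-allFin)

  ∈-candidates : ∀ k {F v e s xs} → (∀ {ys} → Path F v ys e → (v ∷ flat s) ⊆ ys) → Path F v xs e → length xs ≤ k →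
                 (v , s) ∈ candidates k F
  ∈-candidates k {F} {v} {e} {s} visits q l with canonicalPath-path k q l
  ... | r , l′ with parse-complete k [] s (Sublistₚ.∷ˡ⁻ (visits r)) l′
  ...   | w , i , eq = ∈-concatMap-intro _ (∈ₚ.∈-allFin v) (∈-concatMap-intro (candidatesBetween k F v) (∈ₚ.∈-allFin e)
          (subst (λ z → (v , z) ∈ candidatesBetween k F v e) (cong proj₂ eq) (∈ₚ.∈-map⁺ _ i)))

-- Matrices

lookup-ext : ∀ {A : Set} {m} {xs ys : Vec A m} → (∀ i → lookup xs i ≡ lookup ys i) → xs ≡ ys
lookup-ext {xs = xs} {ys} h = trans (sym (Vecₚ.tabulate∘lookup xs)) (trans (Vecₚ.tabulate-cong h) (Vecₚ.tabulate∘lookup ys))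

module _ {n : ℕ} where

  matrix : Graph n → Matrix n
  matrix E = tabulate λ i → tabulate (E i)

  adj-matrix : ∀ E i j → adj (matrix E) i j ≡ E i j
  adj-matrix E i j = trans (cong (λ r → lookup r j) (Vecₚ.lookup∘tabulate (λ i → tabulate (E i)) i)) (Vecₚ.lookup∘tabulate (E i) j)

  adj-ext : ∀ {M N : Matrix n} → (∀ i j → adj M i j ≡ adj N i j) → M ≡ N
  adj-ext h = lookup-ext λ i → lookup-ext (h i)

  isSimple⇒simple : ∀ {M : Matrix n} → IsSimple M → Simple (adj M)
  isSimple⇒simple (symm , irrefl) = record
    { symm = λ x y → bool-cong (symm x y) (symm y x) ; irrefl = λ x → ≢true⇒false (irrefl x) }

  simple-matrix : ∀ {E} → Simple E → Simple (adj (matrix E))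
  simple-matrix {E} S = record
    { symm   = λ x y → trans (adj-matrix E x y) (trans (Simple.symm S x y) (sym (adj-matrix E y x)))
    ; irrefl = λ x → trans (adj-matrix E x x) (Simple.irrefl S x) }

  matrix-ExC6 : ∀ {E} → Simple E → NoLongCycle E → ExC6 n (matrix E)
  matrix-ExC6 {E} S L = ((λ _ _ → Simple.adj-sym S′) , λ x → false≢true (Simple.irrefl S′ x)) ,
    noLongCycle⇒noMinor (subgraph-noLongCycle (λ x y → trans (sym (adj-matrix E x y))) L)
    where S′ = simple-matrix S

-- Neighbour lists and the maximum degree

positions : ∀ {m} → Vec Bool m → List (Fin m)
positions Vec.[]             = []
positions (true  Vec.∷ bs) = zero ∷ map suc (positions bs)
positions (false Vec.∷ bs) = map suc (positions bs)

length-positions : ∀ {m} (bs : Vec Bool m) → length (positions bs) ≡ sum (map (λ b → if b then 1 else 0) (toList bs))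
length-positions Vec.[]           = refl
length-positions (true  Vec.∷ bs) = cong suc (trans (Listₚ.length-map suc (positions bs)) (length-positions bs))
length-positions (false Vec.∷ bs) = trans (Listₚ.length-map suc (positions bs)) (length-positions bs)

unique-positions : ∀ {m} (bs : Vec Bool m) → Unique (positions bs)
unique-positions Vec.[]           = []
unique-positions (true  Vec.∷ bs) = Allₚ.map⁺ (All.tabulate λ _ ()) ∷ Uniqueₚ.map⁺ Finₚ.suc-injective (unique-positions bs)
unique-positions (false Vec.∷ bs) = Uniqueₚ.map⁺ Finₚ.suc-injective (unique-positions bs)

all-positions : ∀ {m} (bs : Vec Bool m) → All (λ i → lookup bs i ≡ true) (positions bs)
all-positions Vec.[]           = []
all-positions (true  Vec.∷ bs) = refl ∷ Allₚ.map⁺ (all-positions bs)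
all-positions (false Vec.∷ bs) = Allₚ.map⁺ (all-positions bs)

maximum-attained : ∀ {m} {k} (f : Fin m → ℕ) → k < foldr _⊔_ 0 (toList (tabulate f)) → ∃ λ i → k < f i
maximum-attained {suc m} {k} f h with ⊔-sel (f zero) (foldr _⊔_ 0 (toList (tabulate (f ∘ suc))))
... | inj₁ eq = zero , subst (k <_) eq h
... | inj₂ eq = let (i , l) = maximum-attained (f ∘ suc) (subst (k <_) eq h) in suc i , l

-- Existence of plans

¬¬-∀ : ∀ {m} {P : Fin m → Set} → (∀ i → ¬ ¬ P i) → ¬ ¬ (∀ i → P i)
¬¬-∀ {zero}  h k = k λ ()
¬¬-∀ {suc m} h k = h zero λ p₀ → ¬¬-∀ (h ∘ suc) λ ps → k λ { zero → p₀ ; (suc i) → ps i }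

¬¬-All : ∀ {A : Set} {P : A → Set} {xs} → (∀ {x} → x ∈ xs → ¬ ¬ P x) → ¬ ¬ All P xs
¬¬-All {xs = []}     h k = k []
¬¬-All {xs = x ∷ xs} h k = h (here refl) λ p → ¬¬-All (h ∘ there) λ ps → k (p ∷ ps)

record PlanOf {n} (m : ℕ) (M : Matrix n) : Set where
  field
    root   : Fin n
    pieces : List (Piece n)
    isPlan : IsPlan (adj M) root pieces
    size≡  : size (map outline pieces) ≡ m

module _ {n : ℕ} {M : Matrix n} where

  ExC6⇒simple : ExC6 n M → Simple (adj M)
  ExC6⇒simple (S , _) = isSimple⇒simple {M = M} S

  ExC6⇒noLongCycle : ExC6 n M → NoLongCycle (adj M)
  ExC6⇒noLongCycle ex@(_ , noMinor) = noMinor⇒noLongCycle (ExC6⇒simple ex) noMinor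

  -- The double negation provides decidable reachability for free.
  planOf : ∀ m → ExC6 n M → 13 * m < maxDegree M → ¬ ¬ PlanOf m M
  planOf m ex big noPlan with maximum-attained (degree M) big
  ... | v , bigv =
    ¬¬-∀ (λ x → ¬¬-∀ λ y → ¬¬-excluded-middle) λ j₁ →
    ¬¬-∀ (λ c → ¬¬-∀ λ x → ¬¬-∀ λ y → ¬¬-excluded-middle) λ j₂ →
    noPlan (build j₁ j₂)
    where
    ns = positions (lookup M v)
    build : (∀ x y → Dec (Joined (adj M) (_≢ v) x y)) → (∀ c x y → Dec (Joined (adj M) (λ z → z ≢ v × z ≢ c) x y)) → PlanOf m M
    build j₁ j₂ with Structure.findPlan (ExC6⇒simple ex) (ExC6⇒noLongCycle ex) v j₁ j₂ (length ns) ns ≤-refl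
                       (unique-positions (lookup M v)) (all-positions (lookup M v))
    ... | Ps , isPs , _ , l with trimPlan m Ps isPs
             (<⇒≤ (*-cancelˡ-< 13 m _ (≤-trans bigv (≤-trans (≤-reflexive (sym (length-positions (lookup M v)))) l))))
    ...   | Qs , isQs , eq , _ = record { root = v ; pieces = Qs ; isPlan = isQs ; size≡ = eq }

-- Double counting

module _ {n : ℕ} (m : ℕ) where

  pathLength : ℕ
  pathLength = suc (2 * m)

  Marked : Set
  Marked = Matrix n × Fin n × Skeleton n

  -- Root and ordered skeleton pass unchanged to the new graph, since `run-injective` needs exactly
  -- these to recover the old one. The regions occur only in the witness `pieces`.
  record Becomes (x y : Marked) : Set where
    field
      simple : Simple (adj (proj₁ x))
      pieces : List (Piece n)
      isPlan : IsPlan (adj (proj₁ x)) (proj₁ (proj₂ x)) pieces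
      isSk   : map outline pieces ≡ proj₂ (proj₂ x)
      size≡  : size (proj₂ (proj₂ x)) ≡ m
      same   : proj₂ x ≡ proj₂ y
      result : proj₁ y ≡ matrix (proj₁ (run m (adj (proj₁ x)) (proj₁ (proj₂ x)) pieces))

  becomes-injective : ∀ {x x′ y} → Becomes x y → Becomes x′ y → x ≡ x′
  becomes-injective {M , v , s} {M′ , _ , _} {N , .v , .s}
    record { simple = S ; pieces = Ps ; isPlan = isPs ; isSk = refl ; size≡ = sz ; same = refl ; result = r }
    record { simple = S′ ; pieces = Ps′ ; isPlan = isPs′ ; isSk = eq ; same = refl ; result = r′ } =
    cong (_, v , s) (adj-ext (run-injective m sz (sym eq) S S′ isPs isPs′ λ x y →
      trans (sym (adj-matrix _ x y)) (trans (cong (λ A → adj A x y) (trans (sym r) r′)) (adj-matrix _ x y))))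

  marked : ∀ {Ms : List (Matrix n)} → All (PlanOf m) Ms → List Marked
  marked [] = []
  marked {M ∷ Ms} (P ∷ Ps) = map (λ s → M , PlanOf.root P , s) (orders (map outline (PlanOf.pieces P))) ++ marked Ps

  ∈-marked⁻ : ∀ {Ms} (Ps : All (PlanOf m) Ms) {x} → x ∈ marked Ps → proj₁ x ∈ Ms
  ∈-marked⁻ {M ∷ Ms} (P ∷ Ps) i with ∈ₚ.∈-++⁻ (map (λ s → M , PlanOf.root P , s) (orders (map outline (PlanOf.pieces P)))) i
  ... | inj₂ j = there (∈-marked⁻ Ps j)
  ... | inj₁ j with ∈ₚ.∈-map⁻ _ j
  ...   | _ , _ , refl = here refl

  unique-marked : ∀ {Ms} → Unique Ms → (Ps : All (PlanOf m) Ms) → Unique (marked Ps)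
  unique-marked [] [] = []
  unique-marked {M ∷ Ms} (M≢ ∷ u) (P ∷ Ps) =
    Uniqueₚ.++⁺ (Uniqueₚ.map⁺ (λ { refl → refl }) (let (a , b) = plan-unique (PlanOf.isPlan P) in unique-orders a b))
      (unique-marked u Ps) disj
    where
    disj : ∀ {x} → ¬ (x ∈ map (λ s → M , PlanOf.root P , s) (orders (map outline (PlanOf.pieces P))) × x ∈ marked Ps)
    disj (i , j) with ∈ₚ.∈-map⁻ _ i
    ... | _ , _ , refl = All.lookup M≢ (∈-marked⁻ Ps j) refl

  length-marked : ∀ {w} → (∀ s → size {n} s ≡ m → w ≤ orderCount s) → ∀ {Ms} (Ps : All (PlanOf m) Ms) → length Ms * w ≤ length (marked Ps)
  length-marked h [] = z≤n
  length-marked h {M ∷ Ms} (P ∷ Ps) = ≤-trans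
    (+-mono-≤ (≤-trans (h _ (PlanOf.size≡ P)) (≤-reflexive (trans (sym (length-orders (map outline (PlanOf.pieces P))))
                (sym (Listₚ.length-map (λ s → M , PlanOf.root P , s) (orders (map outline (PlanOf.pieces P)))))))) (length-marked h Ps))
    (≤-reflexive (sym (Listₚ.length-++ (map (λ s → M , PlanOf.root P , s) (orders (map outline (PlanOf.pieces P)))))))

  size-↭ : ∀ {s t : Skeleton n} → s ↭ t → size s ≡ size t
  size-↭ _↭_.refl = refl
  size-↭ (_↭_.prep (_ , us) σ) = cong (λ k → suc (length us + k)) (size-↭ σ)
  size-↭ {_ ∷ _ ∷ s} (_↭_.swap (_ , us) (_ , ws) σ) = cong suc (begin
    length us + suc (length ws + size s)   ≡⟨ +-suc (length us) _ ⟩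
    suc (length us + (length ws + size s)) ≡⟨ cong suc (sym (+-assoc (length us) (length ws) (size s))) ⟩
    suc (length us + length ws + size s)   ≡⟨ cong₂ (λ i j → suc (i + j)) (+-comm (length us) (length ws)) (size-↭ σ) ⟩
    suc (length ws + length us + _)        ≡⟨ cong suc (+-assoc (length ws) (length us) _) ⟩
    suc (length ws + (length us + _))      ≡⟨ sym (+-suc (length ws) _) ⟩
    length ws + suc (length us + _)        ∎)
    where open ≡-Reasoning
  size-↭ (_↭_.trans σ τ) = trans (size-↭ σ) (size-↭ τ)

  size-orders : ∀ {s t : Skeleton n} → t ∈ orders s → size t ≡ size s
  size-orders {s} i with ∈-arrangements⁻ proj₁ (map choices s) i
  ... | bs , h , σ = trans (sym (size-↭ σ)) (go s h)
    where
    go : ∀ s {bs} → Pointwise (λ b (c : Fin n × List (Fin n × List (Fin n))) → b ∈ proj₂ c) bs (map choices s) → size bs ≡ size s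
    go [] [] = refl
    go ((c , us) ∷ s) (j ∷ h) with ∈ₚ.∈-map⁻ (c ,_) j
    ... | ws , k , refl = cong₂ (λ i j → suc (i + j)) (sym (↭-length (permutations-↭ us k))) (go s h)

  images : List (Matrix n) → List Marked
  images Ns = concatMap (λ N → map (N ,_) (candidates pathLength (adj N))) Ns

  length-images : ∀ Ns → length (images Ns) ≡ length Ns * (n * (n * 3 ^ pathLength))
  length-images Ns = length-concatMap Ns λ {N} _ →
    trans (Listₚ.length-map (N ,_) (candidates pathLength (adj N))) (length-candidates pathLength (adj N))

  adj-path : ∀ {E : Graph n} {x xs y} → Path E x xs y → Path (adj (matrix E)) x xs y
  adj-path {E} q = path-map (λ x y → trans (adj-matrix E x y)) q

  path-adj : ∀ {E : Graph n} {x xs y} → Path (adj (matrix E)) x xs y → Path E x xs y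
  path-adj {E} q = path-map (λ x y → trans (sym (adj-matrix E x y))) q

  marked-becomes : ∀ {Ms Ns} → All (ExC6 n) Ms → (∀ {N} → ExC6 n N → N ∈ Ns) → (Ps : All (PlanOf m) Ms) →
                   ∀ {x} → x ∈ marked Ps → ∃ λ y → y ∈ images Ns × Becomes x y
  marked-becomes {M ∷ Ms} {Ns} (ex ∷ exs) all (P ∷ Ps) i
    with ∈ₚ.∈-++⁻ (map (λ s → M , PlanOf.root P , s) (orders (map outline (PlanOf.pieces P)))) i
  ... | inj₂ j = marked-becomes exs all Ps j
  ... | inj₁ j with ∈ₚ.∈-map⁻ _ j
  ...   | s , k , refl with reorder (PlanOf.isPlan P) k
  ...     | Qs , isQs , refl = (matrix F , v , s) ,
    ∈-concatMap-intro _ (all (matrix-ExC6 spec.simple spec.noLong))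
      (∈ₚ.∈-map⁺ (matrix F ,_) (∈-candidates pathLength (λ q → spec.visits (path-adj q)) (adj-path (proj₁ (proj₂ spec.short))) short)) ,
    record { simple = ExC6⇒simple ex ; pieces = Qs ; isPlan = isQs ; isSk = refl ; size≡ = sz ; same = refl ; result = refl }
    where
    v = PlanOf.root P
    sz : size s ≡ m
    sz = trans (size-orders k) (PlanOf.size≡ P)
    F = proj₁ (run m (adj M) v Qs)
    module spec = RunSpec (run-spec m sz (ExC6⇒simple ex) (ExC6⇒noLongCycle ex) isQs)
    short : length (proj₁ spec.short) ≤ pathLength
    short = ≤-trans (proj₂ (proj₂ spec.short)) (≤-reflexive (cong (λ k → suc (2 * k)) sz))

  double-count : ∀ {w Ms Ns} → (∀ s → size {n} s ≡ m → w ≤ orderCount s) → Unique Ms → All (ExC6 n) Ms →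
                 (∀ {N} → ExC6 n N → N ∈ Ns) → All (PlanOf m) Ms → length Ms * w ≤ length Ns * (n * (n * 3 ^ pathLength))
  double-count {w} {Ms} {Ns} h u exs all Ps = begin
    length Ms * w                            ≤⟨ length-marked h Ps ⟩
    -- Injectivity is `run-injective`, and `visits` with `short` puts each image among the
    -- candidates.
    length (marked Ps)                       ≤⟨ injective-length≤ becomes-injective (unique-marked u Ps) (marked-becomes exs all Ps) ⟩
    length (images Ns)                       ≡⟨ length-images Ns ⟩
    length Ns * (n * (n * 3 ^ pathLength))   ∎
    where open ≤-Reasoning

-- Estimates

n<2^n : ∀ n → n < 2 ^ n
n<2^n zero    = s≤s z≤n
n<2^n (suc n) = ≤-trans (+-mono-≤ (m^n>0 2 n) (n<2^n n)) (≤-reflexive (cong (2 ^ n +_) (sym (+-identityʳ (2 ^ n)))))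

n<2^[1+log₂n] : ∀ n → n < 2 ^ suc ⌊log₂ n ⌋
n<2^[1+log₂n] n = ≰⇒> λ h → <-irrefl refl (≤-trans (≤-reflexive (sym (⌊log₂[2^n]⌋≡n (suc ⌊log₂ n ⌋)))) (⌊log₂⌋-mono-≤ h))

2^[log₂n]≤n : ∀ n → 1 ≤ n → 2 ^ ⌊log₂ n ⌋ ≤ n
2^[log₂n]≤n = <-rec (λ n → 1 ≤ n → 2 ^ ⌊log₂ n ⌋ ≤ n) λ
  { (suc zero) _ _ → s≤s z≤n
  ; n@(suc (suc k)) rec _ → begin
      2 ^ ⌊log₂ n ⌋                 ≡⟨ cong (2 ^_) (log₂-half n (s≤s (s≤s z≤n))) ⟩
      2 * 2 ^ ⌊log₂ ⌊ n /2⌋ ⌋       ≤⟨ *-monoʳ-≤ 2 (rec (⌊n/2⌋<n (suc k)) (s≤s z≤n)) ⟩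
      2 * ⌊ n /2⌋                   ≡⟨ cong (⌊ n /2⌋ +_) (+-identityʳ ⌊ n /2⌋) ⟩
      ⌊ n /2⌋ + ⌊ n /2⌋             ≤⟨ +-monoʳ-≤ ⌊ n /2⌋ (⌊n/2⌋≤⌈n/2⌉ n) ⟩
      ⌊ n /2⌋ + ⌈ n /2⌉             ≡⟨ ⌊n/2⌋+⌈n/2⌉≡n n ⟩
      n                             ∎ }
  where
  open ≤-Reasoning
  log₂-half : ∀ n → 2 ≤ n → ⌊log₂ n ⌋ ≡ suc ⌊log₂ ⌊ n /2⌋ ⌋
  log₂-half n 2≤n = sym (trans (cong suc (⌊log₂⌊n/2⌋⌋≡⌊log₂n⌋∸1 n)) (m+[n∸m]≡n (⌊log₂⌋-mono-≤ 2≤n)))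

-- All factors of r! beyond the B-th are at least B, so at most `B ^ B` is lost.
factorial-bound : ∀ B r → 1 ≤ B → B ^ r ≤ r ! * B ^ B
factorial-bound B zero    1≤B = ≤-trans (m^n>0 B {{>-nonZero 1≤B}} B) (≤-reflexive (sym (+-identityʳ (B ^ B))))
factorial-bound B (suc r) 1≤B with suc r ≤? B
... | yes r<B = ≤-trans (^-monoʳ-≤ B {{>-nonZero 1≤B}} r<B) (m≤n*m (B ^ B) (suc r !) {{suc r !≢0}})
... | no r≮B = ≤-trans (*-mono-≤ (≤-trans (≤-pred (≰⇒> r≮B)) (n≤1+n r)) (factorial-bound B r 1≤B))
                       (≤-reflexive (sym (*-assoc (suc r) (r !) (B ^ B))))

module _ {n : ℕ} where

  leafCount : Skeleton n → ℕ
  leafCount []             = 0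
  leafCount ((_ , us) ∷ s) = length us + leafCount s

  size≡length+leafCount : ∀ s → size s ≡ length s + leafCount s
  size≡length+leafCount [] = refl
  size≡length+leafCount ((_ , us) ∷ s) = cong suc (begin
    length us + size s                     ≡⟨ cong (length us +_) (size≡length+leafCount s) ⟩
    length us + (length s + leafCount s)   ≡⟨ sym (+-assoc (length us) (length s) (leafCount s)) ⟩
    length us + length s + leafCount s     ≡⟨ cong (_+ leafCount s) (+-comm (length us) (length s)) ⟩
    length s + length us + leafCount s     ≡⟨ +-assoc (length s) (length us) (leafCount s) ⟩
    length s + (length us + leafCount s)   ∎)
    where open ≡-Reasoning

  -- The leaf factorials lose `B ^ B` once per anchor. The factor q! is kept whole to repay this in
  -- `orderCount-bound`.
  orderCount-leaves : ∀ B s → 1 ≤ B → length s ! * B ^ leafCount s ≤ orderCount s * (B ^ B) ^ length s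
  orderCount-leaves B [] _ = ≤-refl
  orderCount-leaves B ((_ , us) ∷ s) 1≤B = begin
    (suc q * q !) * B ^ (r + R)                    ≡⟨ cong ((suc q * q !) *_) (^-distribˡ-+-* B r R) ⟩
    (suc q * q !) * (B ^ r * B ^ R)                ≡⟨ rearrange₁ (suc q) (q !) (B ^ r) (B ^ R) ⟩
    suc q * (B ^ r * (q ! * B ^ R))                ≤⟨ *-monoʳ-≤ (suc q) (*-mono-≤ (factorial-bound B r 1≤B) (orderCount-leaves B s 1≤B)) ⟩
    suc q * ((r ! * D) * (orderCount s * D ^ q))   ≡⟨ rearrange₂ (suc q) (r !) D (orderCount s) (D ^ q) ⟩
    (r ! * (orderCount s * suc q)) * (D * D ^ q)   ∎
    where
    open ≤-Reasoning
    q = length s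
    r = length us
    R = leafCount s
    D = B ^ B
    rearrange₁ : ∀ a b c d → (a * b) * (c * d) ≡ a * (c * (b * d))
    rearrange₁ = solve-∀
    rearrange₂ : ∀ a b c d e → a * ((b * c) * (d * e)) ≡ (b * (d * a)) * (c * e)
    rearrange₂ = solve-∀

  -- With A = B^(2B), each of the q! · ∏ rᵢ! factorials is bounded below at its own scale: q! at A and rᵢ! at B.
  orderCount-bound : ∀ B s → 1 ≤ B → B ^ size s ≤ orderCount s * (B ^ (2 * B)) ^ (B ^ (2 * B))
  orderCount-bound B s 1≤B = *-cancelʳ-≤ _ _ (D ^ q) {{>-nonZero (m^n>0 D {{>-nonZero (m^n>0 B {{>-nonZero 1≤B}} B)}} q)}} (begin
    B ^ size s * D ^ q                        ≡⟨ cong₂ _*_ (cong (B ^_) (size≡length+leafCount s)) (^-*-assoc B B q) ⟩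
    B ^ (q + R) * B ^ (B * q)                 ≡⟨ sym (^-distribˡ-+-* B (q + R) (B * q)) ⟩
    B ^ (q + R + B * q)                       ≤⟨ ^-monoʳ-≤ B {{>-nonZero 1≤B}} exponents ⟩
    B ^ (2 * B * q + R)                       ≡⟨ ^-distribˡ-+-* B (2 * B * q) R ⟩
    B ^ (2 * B * q) * B ^ R                   ≡⟨ cong (_* B ^ R) (sym (^-*-assoc B (2 * B) q)) ⟩
    A ^ q * B ^ R                             ≤⟨ *-monoˡ-≤ (B ^ R) (factorial-bound A q (m^n>0 B {{>-nonZero 1≤B}} (2 * B))) ⟩
    q ! * A ^ A * B ^ R                       ≡⟨ swap₁ (q !) (A ^ A) (B ^ R) ⟩
    q ! * B ^ R * A ^ A                       ≤⟨ *-monoˡ-≤ (A ^ A) (orderCount-leaves B s 1≤B) ⟩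
    orderCount s * D ^ q * A ^ A              ≡⟨ swap₁ (orderCount s) (D ^ q) (A ^ A) ⟩
    orderCount s * A ^ A * D ^ q              ∎)
    where
    open ≤-Reasoning
    q = length s
    R = leafCount s
    D = B ^ B
    A = B ^ (2 * B)
    swap₁ : ∀ a b c → a * b * c ≡ a * c * b
    swap₁ = solve-∀
    regroup : ∀ q R B → (B * q) + R + B * q ≡ 2 * B * q + R
    regroup = solve-∀
    -- The anchors need `q` and the losses at the leaves `B * q`. Both fit into `2 * B * q`, which
    -- is why A has the exponent `2 * B`.
    exponents : q + R + B * q ≤ 2 * B * q + R
    exponents = ≤-trans (+-monoˡ-≤ (B * q) (+-monoˡ-≤ R (m≤n*m q B {{>-nonZero 1≤B}}))) (≤-reflexive (regroup q R B))

module Estimate (k n : ℕ) where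

  x y z w B A : ℕ
  x = ⌊log₂ n ⌋
  y = ⌊log₂ x ⌋
  z = ⌊log₂ y ⌋
  -- So log₂ B is about z / 4. One factor `2 ^ w` of B will pay for the three symbols and the other
  -- for everything else, while the divisor 8 leaves room for `A^A≤2^x`.
  w = z / 8
  B = 2 ^ (2 * w)
  A = B ^ (2 * B)

  module _ (32≤z : 32 ≤ z) (k≤x : 3 * suc k ≤ x) where

    instance
      z≢0 : NonZero z
      z≢0 = >-nonZero (≤-trans (s≤s z≤n) 32≤z)

    m : ℕ
    m = 129 * x / z

    open ≤-Reasoning

    log₂-positive : ∀ a → 1 ≤ ⌊log₂ a ⌋ → 1 ≤ a
    log₂-positive (suc a) _ = s≤s z≤n

    1≤y : 1 ≤ y
    1≤y = log₂-positive y (≤-trans (s≤s z≤n) 32≤z)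

    1≤x : 1 ≤ x
    1≤x = log₂-positive x 1≤y

    1≤n : 1 ≤ n
    1≤n = log₂-positive n 1≤x

    2^z≤y : 2 ^ z ≤ y
    2^z≤y = 2^[log₂n]≤n y 1≤y

    2^y≤x : 2 ^ y ≤ x
    2^y≤x = 2^[log₂n]≤n x 1≤x

    z≤x : z ≤ x
    z≤x = ≤-trans (<⇒≤ (n<2^n z)) (≤-trans 2^z≤y (≤-trans (<⇒≤ (n<2^n y)) 2^y≤x))

    4≤w : 4 ≤ w
    4≤w = /-monoˡ-≤ 8 32≤z

    8w≤z : 8 * w ≤ z
    8w≤z = ≤-trans (≤-reflexive (*-comm 8 w)) (m/n*n≤m z 8)

    z≤16w : z ≤ 16 * w
    z≤16w = begin
      z               ≡⟨ m≡m%n+[m/n]*n z 8 ⟩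
      z % 8 + w * 8   ≤⟨ +-monoˡ-≤ (w * 8) (≤-trans (<⇒≤ (m%n<n z 8)) (*-monoˡ-≤ 8 (≤-trans (s≤s z≤n) 4≤w))) ⟩
      w * 8 + w * 8   ≡⟨ double w ⟩
      16 * w          ∎
      where
      double : ∀ w → w * 8 + w * 8 ≡ 16 * w
      double = solve-∀

    m*z≤ : m * z ≤ 129 * x
    m*z≤ = m/n*n≤m (129 * x) z

    -- Rounding in m loses at most z, hence at most x, so `m * z` is at least `128 * x`: the 129th
    -- share covers the rounding. Rounding in w costs at most a factor two, so `z ≤ 16 * w`, and
    -- this is more than sufficient.
    6x≤w*m : 6 * x ≤ w * m
    6x≤w*m = *-cancelˡ-≤ 16 (begin
      16 * (6 * x)   ≡⟨ sym (*-assoc 16 6 x) ⟩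
      96 * x         ≤⟨ *-monoˡ-≤ x (m≤m+n 96 32) ⟩
      128 * x        ≤⟨ +-cancelˡ-≤ x (128 * x) (m * z) (begin
        x + 128 * x              ≡⟨ m≡m%n+[m/n]*n (129 * x) z ⟩
        (129 * x) % z + m * z    ≤⟨ +-monoˡ-≤ (m * z) (≤-trans (<⇒≤ (m%n<n (129 * x) z)) z≤x) ⟩
        x + m * z                ∎) ⟩
      m * z          ≤⟨ *-monoʳ-≤ m z≤16w ⟩
      m * (16 * w)   ≡⟨ regroup m w ⟩
      16 * (w * m)   ∎)
      where
      regroup : ∀ m w → m * (16 * w) ≡ 16 * (w * m)
      regroup = solve-∀

    -- With `A = 2 ^ e`, the exponent of 2 in `A ^ A` is below `2 ^ (2 * e)`, where 2e is little
    -- more than B. It therefore suffices that 2e is at most y, the twice iterated logarithm of n.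
    -- This is what limits log B to the order of the third one.
    A^A≤2^x : A ^ A ≤ 2 ^ x
    A^A≤2^x = begin
      A ^ A                 ≡⟨ cong (λ a → a ^ a) (^-*-assoc 2 (2 * w) (2 * B)) ⟩
      (2 ^ e) ^ (2 ^ e)     ≡⟨ ^-*-assoc 2 e (2 ^ e) ⟩
      2 ^ (e * 2 ^ e)       ≤⟨ ^-monoʳ-≤ 2 (begin
        e * 2 ^ e             ≤⟨ *-monoˡ-≤ (2 ^ e) (<⇒≤ (n<2^n e)) ⟩
        2 ^ e * 2 ^ e         ≡⟨ sym (^-distribˡ-+-* 2 e e) ⟩
        2 ^ (e + e)           ≤⟨ ^-monoʳ-≤ 2 (≤-trans 2e≤2^z 2^z≤y) ⟩
        2 ^ y                 ≤⟨ 2^y≤x ⟩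
        x                     ∎) ⟩
      2 ^ x                 ∎
      where
      e = 2 * w * (2 * B)
      regroup : ∀ w B → 2 * w * (2 * B) + 2 * w * (2 * B) ≡ 8 * w * B
      regroup = solve-∀
      collect : ∀ w → 3 + w + 2 * w ≡ 3 + 3 * w
      collect = solve-∀
      spread : ∀ w → w + 3 * w ≡ 4 * w
      spread = solve-∀
      2e≤2^z : e + e ≤ 2 ^ z
      2e≤2^z = begin
        e + e                     ≡⟨ regroup w B ⟩
        8 * w * B                 ≤⟨ *-monoˡ-≤ B (*-monoʳ-≤ 8 (<⇒≤ (n<2^n w))) ⟩
        2 ^ 3 * 2 ^ w * B         ≡⟨ cong (_* B) (sym (^-distribˡ-+-* 2 3 w)) ⟩
        2 ^ (3 + w) * 2 ^ (2 * w) ≡⟨ sym (^-distribˡ-+-* 2 (3 + w) (2 * w)) ⟩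
        2 ^ (3 + w + 2 * w)       ≤⟨ ^-monoʳ-≤ 2 (begin
          3 + w + 2 * w             ≡⟨ collect w ⟩
          3 + 3 * w                 ≤⟨ +-monoˡ-≤ (3 * w) (≤-trans (n≤1+n 3) 4≤w) ⟩
          w + 3 * w                 ≡⟨ spread w ⟩
          4 * w                     ≤⟨ *-monoˡ-≤ w (m≤m+n 4 4) ⟩
          8 * w                     ≤⟨ 8w≤z ⟩
          z                         ∎) ⟩
        2 ^ z                     ∎

    n≤2^2x : n ≤ 2 ^ (2 * x)
    n≤2^2x = ≤-trans (<⇒≤ (n<2^[1+log₂n] n)) (^-monoʳ-≤ 2 (begin
      1 + x   ≤⟨ +-monoˡ-≤ x 1≤x ⟩
      x + x   ≡⟨ cong (x +_) (sym (+-identityʳ x)) ⟩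
      2 * x   ∎))

    3^≤ : 3 ^ suc (2 * m) ≤ 3 * 2 ^ (w * m)
    3^≤ = *-monoʳ-≤ 3 (begin
      3 ^ (2 * m)    ≡⟨ sym (^-*-assoc 3 2 m) ⟩
      9 ^ m          ≤⟨ ^-monoˡ-≤ m (≤-trans (m≤m+n 9 7) (^-monoʳ-≤ 2 4≤w)) ⟩
      (2 ^ w) ^ m    ≡⟨ ^-*-assoc 2 w m ⟩
      2 ^ (w * m)    ∎)

    -- Of the `2 * w * m` bits of `B ^ m`, half pay for `9 ^ m`. The other half are at least
    -- `6 * x`: `2 * x` for each factor n, `x` for `A ^ A`, and `x` for `3 * suc k`, whose 3 is left
    -- over from the odd exponent.
    few : suc k * (n * (n * 3 ^ suc (2 * m))) * A ^ A ≤ B ^ m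
    few = begin
      suc k * (n * (n * 3 ^ suc (2 * m))) * A ^ A                  ≤⟨ *-mono-≤ (*-monoʳ-≤ (suc k) (*-mono-≤ n≤2^2x (*-mono-≤ n≤2^2x 3^≤))) A^A≤2^x ⟩
      suc k * (2 ^ (2 * x) * (2 ^ (2 * x) * (3 * W))) * 2 ^ x      ≡⟨ gather (suc k) (2 ^ (2 * x)) W (2 ^ x) ⟩
      3 * suc k * (2 ^ x * (2 ^ (2 * x) * (2 ^ (2 * x) * W)))      ≤⟨ *-monoˡ-≤ _ (≤-trans k≤x (<⇒≤ (n<2^n x))) ⟩
      2 ^ x * (2 ^ x * (2 ^ (2 * x) * (2 ^ (2 * x) * W)))          ≡⟨ cong (λ a → 2 ^ x * (2 ^ x * (2 ^ (2 * x) * a))) (sym (^-distribˡ-+-* 2 (2 * x) (w * m))) ⟩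
      2 ^ x * (2 ^ x * (2 ^ (2 * x) * 2 ^ (2 * x + w * m)))        ≡⟨ cong (λ a → 2 ^ x * (2 ^ x * a)) (sym (^-distribˡ-+-* 2 (2 * x) (2 * x + w * m))) ⟩
      2 ^ x * (2 ^ x * 2 ^ (2 * x + (2 * x + w * m)))              ≡⟨ cong (2 ^ x *_) (sym (^-distribˡ-+-* 2 x (2 * x + (2 * x + w * m)))) ⟩
      2 ^ x * 2 ^ (x + (2 * x + (2 * x + w * m)))                  ≡⟨ sym (^-distribˡ-+-* 2 x (x + (2 * x + (2 * x + w * m)))) ⟩
      2 ^ (x + (x + (2 * x + (2 * x + w * m))))                    ≡⟨ cong (2 ^_) (six x (w * m)) ⟩
      2 ^ (6 * x + w * m)                                          ≤⟨ ^-monoʳ-≤ 2 (+-monoˡ-≤ (w * m) 6x≤w*m) ⟩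
      2 ^ (w * m + w * m)                                          ≡⟨ cong (2 ^_) (twice w m) ⟩
      2 ^ (2 * w * m)                                              ≡⟨ sym (^-*-assoc 2 (2 * w) m) ⟩
      B ^ m                                                        ∎
      where
      W = 2 ^ (w * m)
      gather : ∀ k a W b → k * (a * (a * (3 * W))) * b ≡ 3 * k * (b * (a * (a * W)))
      gather = solve-∀
      six : ∀ x p → x + (x + (2 * x + (2 * x + p))) ≡ 6 * x + p
      six = solve-∀
      twice : ∀ w m → w * m + w * m ≡ 2 * w * m
      twice = solve-∀

    1≤B : 1 ≤ B
    1≤B = m^n>0 2 (2 * w)

    manyOrders : ∀ s → size {n} s ≡ m → suc k * (n * (n * 3 ^ suc (2 * m))) ≤ orderCount s
    manyOrders s eq = *-cancelʳ-≤ _ _ (A ^ A) {{>-nonZero (m^n>0 A {{>-nonZero (m^n>0 B {{>-nonZero 1≤B}} (2 * B))}} A)}}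
      (≤-trans few (≤-trans (≤-reflexive (cong (B ^_) (sym eq))) (orderCount-bound B s 1≤B)))

-- Thresholds and conclusion

abstract

  eventually-log₂ : ∀ {P : ℕ → Set} → (∃ λ N → ∀ n → N ≤ n → P n) → ∃ λ N → ∀ n → N ≤ n → P ⌊log₂ n ⌋
  eventually-log₂ (N , h) = 2 ^ N , λ n l → h ⌊log₂ n ⌋ (≤-trans (≤-reflexive (sym (⌊log₂[2^n]⌋≡n N))) (⌊log₂⌋-mono-≤ l))

  -- The threshold contains the tower obtained by raising 2 to the power j three times over. The
  -- block is abstract so that it never gets evaluated.
  eventually-large : ∀ j k → ∃ λ N → ∀ n → N ≤ n → j ≤ L3 n × k ≤ L1 n
  eventually-large j k with eventually-log₂ (eventually-log₂ (eventually-log₂ {j ≤_} (j , λ _ l → l))) | eventually-log₂ {k ≤_} (k , λ _ l → l)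
  ... | N , h | N′ , h′ = N + N′ , λ n l → h n (≤-trans (m≤m+n N N′) l) , h′ n (≤-trans (m≤n+m N′ N) l)

-- Convergence to 1 is expressed without division: for every k the share of exceptional graphs is
-- eventually at most 1/(k+1). Passing to integer logarithms in base 2 changes the bound by a
-- constant factor for large n.
theorem12 : ∃[ C ] (1 ≤ C × (∀ (k : ℕ) → ∃[ N ] (∀ (n : ℕ) → N ≤ n → ∀ (t b : ℕ)
    → NumberOf (ExC6 n) t
    → NumberOf (λ M → ExC6 n M × ¬ (maxDegree M * L3 n ≤ C * L1 n)) b
    → suc k * b ≤ t)))
-- There is one anchor or leaf for at most 13 neighbours, and about 129 L1 n / L3 n of them are
-- required.
theorem12 = 13 * 129 , s≤s z≤n , λ k → proj₁ (eventually-large 32 (3 * suc k)) , λ n large t b T B →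
  let (32≤z , k≤x) = proj₂ (eventually-large 32 (3 * suc k)) n large in bound k n 32≤z k≤x t b T B
  where
  bound : ∀ k n → 32 ≤ L3 n → 3 * suc k ≤ L1 n → ∀ t b → NumberOf (ExC6 n) t →
          NumberOf (λ M → ExC6 n M × ¬ (maxDegree M * L3 n ≤ 13 * 129 * L1 n)) b → suc k * b ≤ t
  bound k n 32≤z k≤x t b (Ns , _ , refl , ∈Ns) (Ms , uMs , refl , ∈Ms) =
    -- The goal is a decidable inequality, so plans for all exceptional graphs may be assumed
    -- although only their double negation is available.
    decidable-stable (suc k * length Ms ≤? length Ns) λ ¬goal →
      ¬¬-All (λ {M} i → planOf m (proj₁ (bad i)) (highDegree {M} (proj₂ (bad i)))) (¬goal ∘ count)
    where
    open Estimate k n hiding (m)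
    m = Estimate.m k n 32≤z k≤x
    c = n * (n * 3 ^ suc (2 * m))

    bad : ∀ {M} → M ∈ Ms → ExC6 n M × ¬ (maxDegree M * L3 n ≤ 13 * 129 * L1 n)
    bad {M} = Equivalence.to (∈Ms M)

    highDegree : ∀ {M : Matrix n} → ¬ (maxDegree M * L3 n ≤ 13 * 129 * L1 n) → 13 * m < maxDegree M
    highDegree {M} h = *-cancelʳ-< (L3 n) (13 * m) (maxDegree M) (≤-<-trans
      (≤-trans (≤-reflexive (*-assoc 13 m z)) (≤-trans (*-monoʳ-≤ 13 (m*z≤ 32≤z k≤x)) (≤-reflexive (sym (*-assoc 13 129 x)))))
      (≰⇒> h))

    c≢0 : NonZero c
    c≢0 = >-nonZero (*-mono-≤ (1≤n 32≤z k≤x) (*-mono-≤ (1≤n 32≤z k≤x) (m^n>0 3 (suc (2 * m)))))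

    count : All (PlanOf m) Ms → suc k * length Ms ≤ length Ns
    count Ps = *-cancelʳ-≤ _ _ c {{c≢0}} (≤-trans (≤-reflexive (trans (cong (_* c) (*-comm (suc k) (length Ms))) (*-assoc (length Ms) (suc k) c)))
      (double-count m (manyOrders 32≤z k≤x) uMs (All.tabulate (λ i → proj₁ (bad i))) (λ {N} → Equivalence.from (∈Ns N)) Ps))
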